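{- Let $\gamma$ be the Tribonacci constant and let $x,y\in\mathbb Z_{ -\gamma}$. Then $\mathrm{fr}(x+y)\le 6$ and $\mathrm{fr}(x-y)\le 6$; in particular $\mathrm{fr}(-x)\le 6$. In words: the sum and the difference of two $(-\gamma)$-integers have finite $(-\gamma)$-expansions with at most $6$ digits after the radix point.
   Context: Let $\gamma\approx 1.839$ be the unique real root of $x^3-x^2-x-1$ (the Tribonacci constant). Fix a real number $\beta>1$ and set $\ell=\frac{ -\beta}{\beta+1}$. Define $T_{ -\beta}:[\ell,\ell+1)\to[\ell,\ell+1)$ by $T_{ -\beta}(x)=-\beta x-\lfloor -\beta x-\ell\rfloor$. For $x\in[\ell,\ell+1)$, the $(-\beta)$-expansion of $x$ is the digit sequence $d_{ -\beta}(x)=x_1x_2x_3\cdots$ with $x_i=\lfloor -\beta\, T_{ -\beta}^{i-1}(x)-\ell\rfloor\in\{0,1,\dots,\lfloor\beta\rfloor\}$. It satisfies $x=\sum_{i\ge1}x_i(-\beta)^{ -i}$. For arbitrary $x\in\mathbb R$, let $k\ge 0$ be the minimal integer with $x/(-\beta)^k\in(\ell,\ell+1)$ and let $d_{ -\beta}(x/(-\beta)^k)=x_1x_2\cdots$. The $(-\beta)$-expansion of $x$ is $x_1\cdots x_k\bullet x_{k+1}x_{k+2}\cdots$ if $k\ge1$, and $0\bullet x_1x_2\cdots$ if $k=0$. The digits written after the symbol $\bullet$ are the fractional digits. The set of $(-\beta)$-integers $\mathbb Z_{ -\beta}$ is the set of $x\in\mathbb R$ whose $(-\beta)$-expansion has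 only zeros after $\bullet$. Equivalently, $\mathbb Z_{ -\beta}=\bigcup_{i\ge0}(-\beta)^iT_{ -\beta}^{ -i}(0)$. The set of numbers with finite expansion is $\mathrm{Fin}(-\beta)=\bigcup_{i\ge0}(-\beta)^{ -i}\mathbb Z_{ -\beta}$. For $x\in\mathrm{Fin}(-\beta)$ with expansion $x_k\cdots x_0\bullet x_{ -1}\cdots x_{ -n}0^\omega$ and $x_{ -n}\ne0$, set $\mathrm{fr}(x)=n$. Set $\mathrm{fr}(x)=0$ if all fractional digits are zero, and $\mathrm{fr}(x)=+\infty$ if $x\notin\mathrm{Fin}(-\beta)$. -}

module Defs where

open import Data.Integer.Base as ℤ using (ℤ; 0ℤ)
open import Data.Nat.Base as ℕ using (ℕ; zero; suc)
import Data.Nat.Properties as ℕₚ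
open import Data.Product.Base using (Σ; ∃; _×_; _,_)
open import Data.Rational.Base as ℚ using (ℚ; 0ℚ; 1ℚ; ½; ∣_∣)
open import Data.Rational.Properties as ℚₚ using ()
open import Data.Rational.Solver using (module +-*-Solver)
open import Data.Sum.Base using (inj₁; inj₂)
open import Relation.Binary.PropositionalEquality.Core using (_≡_; _≢_; refl; sym; trans; cong; cong₂; subst; subst₂)
open import Relation.Nullary.Construct.Add.Supremum using (_⁺; ⊤⁺; [_])
open import Relation.Nullary.Decidable.Core using (toWitness)
open import Relation.Nullary.Negation.Core using (¬_)

open import Relation.Binary.Construct.Add.Supremum.NonStrict ℕ._≤_ using (_≤⁺_) public

-- Reals are Cauchy sequences of rationals, with limit equality _≃_ as setoid
-- equality and termwise operations.

IsCauchy : (ℕ → ℚ) → Set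
IsCauchy s = ∀ ε → 0ℚ ℚ.< ε →
  ∃ λ N → ∀ m n → N ℕ.≤ m → N ℕ.≤ n → ∣ s m ℚ.- s n ∣ ℚ.≤ ε

record ℝ : Set where
  constructor mkℝ
  field
    seq    : ℕ → ℚ
    cauchy : IsCauchy seq

open ℝ public

infix 4 _≃_ _<_ _≤_

_≃_ : ℝ → ℝ → Set
x ≃ y = ∀ ε → 0ℚ ℚ.< ε → ∃ λ N → ∀ n → N ℕ.≤ n → ∣ seq x n ℚ.- seq y n ∣ ℚ.≤ ε

_<_ : ℝ → ℝ → Set
x < y = ∃ λ ε → 0ℚ ℚ.< ε × ∃ λ N → ∀ n → N ℕ.≤ n → ε ℚ.+ seq x n ℚ.≤ seq y n

_≤_ : ℝ → ℝ → Set
x ≤ y = ∀ ε → 0ℚ ℚ.< ε → ∃ λ N → ∀ n → N ℕ.≤ n → seq x n ℚ.≤ seq y n ℚ.+ ε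

private
  half-pos : ∀ {ε} → 0ℚ ℚ.< ε → 0ℚ ℚ.< ½ ℚ.* ε
  half-pos {ε} 0<ε = subst (ℚ._< ½ ℚ.* ε) (ℚₚ.*-zeroʳ ½) (ℚₚ.*-monoʳ-<-pos ½ 0<ε)

  half+half : ∀ ε → ½ ℚ.* ε ℚ.+ ½ ℚ.* ε ≡ ε
  half+half = solve 1 (λ e → con ½ :* e :+ con ½ :* e := e) refl
    where open +-*-Solver

  *-pos : ∀ {p q} → 0ℚ ℚ.< p → 0ℚ ℚ.< q → 0ℚ ℚ.< p ℚ.* q
  *-pos {p} {q} 0<p 0<q = subst (ℚ._< p ℚ.* q) (ℚₚ.*-zeroʳ p)
    (ℚₚ.*-monoʳ-<-pos p {{ℚ.positive 0<p}} 0<q)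

  *-mono : ∀ {p q r s} → 0ℚ ℚ.≤ q → 0ℚ ℚ.≤ r →
           p ℚ.≤ q → r ℚ.≤ s → p ℚ.* r ℚ.≤ q ℚ.* s
  *-mono {p} {q} {r} {s} 0≤q 0≤r p≤q r≤s = ℚₚ.≤-trans
    (ℚₚ.*-monoʳ-≤-nonNeg r {{ℚ.nonNegative 0≤r}} p≤q)
    (ℚₚ.*-monoˡ-≤-nonNeg q {{ℚ.nonNegative 0≤q}} r≤s)

  rec : ∀ p → 0ℚ ℚ.< p → ℚ
  rec p 0<p = ℚ.1/_ p {{ℚₚ.pos⇒nonZero p {{ℚ.positive 0<p}}}}

  rec-inverse : ∀ p 0<p → rec p 0<p ℚ.* p ≡ 1ℚ
  rec-inverse p 0<p = ℚₚ.*-inverseˡ p {{ℚₚ.pos⇒nonZero p {{ℚ.positive 0<p}}}}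

  rec-pos : ∀ p 0<p → 0ℚ ℚ.< rec p 0<p
  rec-pos p 0<p = ℚₚ.positive⁻¹ (rec p 0<p) {{ℚₚ.1/pos⇒pos p {{ℚ.positive 0<p}}}}

  abstract
    eventually-bounded : ∀ {s} → IsCauchy s →
      ∃ λ B → 0ℚ ℚ.< B × ∃ λ N → ∀ n → N ℕ.≤ n → ∣ s n ∣ ℚ.≤ B
    eventually-bounded {s} c with c 1ℚ (ℚₚ.positive⁻¹ 1ℚ)
    ... | N , h = 1ℚ ℚ.+ ∣ s N ∣
                , ℚₚ.+-mono-<-≤ (ℚₚ.positive⁻¹ 1ℚ) (ℚₚ.0≤∣p∣ (s N))
                , N , λ n N≤n → ℚₚ.≤-trans
                    (subst (ℚ._≤ ∣ s n ℚ.- s N ∣ ℚ.+ ∣ s N ∣) (cong ∣_∣ (lem (s n) (s N)))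
                      (ℚₚ.∣p+q∣≤∣p∣+∣q∣ (s n ℚ.- s N) (s N)))
                    (ℚₚ.+-monoˡ-≤ ∣ s N ∣ (h n N N≤n ℕₚ.≤-refl))
      where
      open +-*-Solver
      lem : ∀ a b → (a ℚ.- b) ℚ.+ b ≡ a
      lem = solve 2 (λ a b → (a :- b) :+ b := a) refl

    +-cauchy : ∀ {s t} → IsCauchy s → IsCauchy t → IsCauchy (λ n → s n ℚ.+ t n)
    +-cauchy {s} {t} cs ct ε 0<ε
      with cs (½ ℚ.* ε) (half-pos 0<ε) | ct (½ ℚ.* ε) (half-pos 0<ε)
    ... | M , hs | N , ht = M ℕ.⊔ N , λ m n m≥ n≥ →
      subst₂ ℚ._≤_ (cong ∣_∣ (lem (s m) (t m) (s n) (t n))) (half+half ε)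
        (ℚₚ.≤-trans (ℚₚ.∣p+q∣≤∣p∣+∣q∣ (s m ℚ.- s n) (t m ℚ.- t n))
          (ℚₚ.+-mono-≤ (hs m n (ℕₚ.m⊔n≤o⇒m≤o M N m≥) (ℕₚ.m⊔n≤o⇒m≤o M N n≥))
                       (ht m n (ℕₚ.m⊔n≤o⇒n≤o M N m≥) (ℕₚ.m⊔n≤o⇒n≤o M N n≥))))
      where
      open +-*-Solver
      lem : ∀ a b c d → (a ℚ.- c) ℚ.+ (b ℚ.- d) ≡ (a ℚ.+ b) ℚ.- (c ℚ.+ d)
      lem = solve 4 (λ a b c d → (a :- c) :+ (b :- d) := (a :+ b) :- (c :+ d)) refl

    neg-cauchy : ∀ {s} → IsCauchy s → IsCauchy (λ n → ℚ.- s n)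
    neg-cauchy {s} cs ε 0<ε with cs ε 0<ε
    ... | N , h = N , λ m n m≥ n≥ →
      subst (λ p → ∣ p ∣ ℚ.≤ ε) (lem (s m) (s n)) (h n m n≥ m≥)
      where
      open +-*-Solver
      lem : ∀ a b → b ℚ.- a ≡ (ℚ.- a) ℚ.- (ℚ.- b)
      lem = solve 2 (λ a b → b :- a := (:- a) :- (:- b)) refl

    *-cauchy : ∀ {s t} → IsCauchy s → IsCauchy t → IsCauchy (λ n → s n ℚ.* t n)
    *-cauchy {s} {t} cs ct ε 0<ε =
      let A , 0<A , K , s≤A = eventually-bounded {s} cs
          B , 0<B , L , t≤B = eventually-bounded {t} ct
          M , hs = cs (rec B 0<B ℚ.* (½ ℚ.* ε)) (*-pos (rec-pos B 0<B) (half-pos 0<ε))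
          N , ht = ct (rec A 0<A ℚ.* (½ ℚ.* ε)) (*-pos (rec-pos A 0<A) (half-pos 0<ε))
      in (K ℕ.⊔ L) ℕ.⊔ (M ℕ.⊔ N) , λ m n m≥ n≥ →
      let m≥₁ = ℕₚ.m⊔n≤o⇒m≤o (K ℕ.⊔ L) (M ℕ.⊔ N) m≥
          m≥₂ = ℕₚ.m⊔n≤o⇒n≤o (K ℕ.⊔ L) (M ℕ.⊔ N) m≥
          n≥₁ = ℕₚ.m⊔n≤o⇒m≤o (K ℕ.⊔ L) (M ℕ.⊔ N) n≥
          n≥₂ = ℕₚ.m⊔n≤o⇒n≤o (K ℕ.⊔ L) (M ℕ.⊔ N) n≥
      in subst₂ ℚ._≤_ (cong ∣_∣ (lem (s m) (t m) (s n) (t n))) (half+half ε)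
        (ℚₚ.≤-trans (ℚₚ.∣p+q∣≤∣p∣+∣q∣ (s m ℚ.* (t m ℚ.- t n)) (t n ℚ.* (s m ℚ.- s n)))
          (ℚₚ.+-mono-≤
            (bound (s m) (t m ℚ.- t n) (½ ℚ.* ε) 0<A (s≤A m (ℕₚ.m⊔n≤o⇒m≤o K L m≥₁))
              (ht m n (ℕₚ.m⊔n≤o⇒n≤o M N m≥₂) (ℕₚ.m⊔n≤o⇒n≤o M N n≥₂)))
            (bound (t n) (s m ℚ.- s n) (½ ℚ.* ε) 0<B (t≤B n (ℕₚ.m⊔n≤o⇒n≤o K L n≥₁))
              (hs m n (ℕₚ.m⊔n≤o⇒m≤o M N m≥₂) (ℕₚ.m⊔n≤o⇒m≤o M N n≥₂)))))
      where
      open +-*-Solver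
      lem : ∀ a b c d → a ℚ.* (b ℚ.- d) ℚ.+ d ℚ.* (a ℚ.- c) ≡ a ℚ.* b ℚ.- c ℚ.* d
      lem = solve 4 (λ a b c d → a :* (b :- d) :+ d :* (a :- c) := a :* b :- c :* d) refl

      swap : ∀ a r e → a ℚ.* (r ℚ.* e) ≡ (r ℚ.* a) ℚ.* e
      swap = solve 3 (λ a r e → a :* (r :* e) := (r :* a) :* e) refl

      cancel : ∀ C 0<C e → C ℚ.* (rec C 0<C ℚ.* e) ≡ e
      cancel C 0<C e = trans (swap C (rec C 0<C) e)
        (trans (cong (ℚ._* e) (rec-inverse C 0<C)) (ℚₚ.*-identityˡ e))

      bound : ∀ {C} p q e (0<C : 0ℚ ℚ.< C) → ∣ p ∣ ℚ.≤ C → ∣ q ∣ ℚ.≤ rec C 0<C ℚ.* e →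
              ∣ p ℚ.* q ∣ ℚ.≤ e
      bound {C} p q e 0<C hp hq =
        subst₂ ℚ._≤_ (sym (ℚₚ.∣p*q∣≡∣p∣*∣q∣ p q)) (cancel C 0<C e)
          (*-mono (ℚₚ.<⇒≤ 0<C) (ℚₚ.0≤∣p∣ q) hp hq)

infixl 6 _+_ _-_
infixl 7 _*_
infixr 8 _^_
infix  8 -_

fromℚ : ℚ → ℝ
fromℚ q = mkℝ (λ _ → q) λ ε 0<ε → 0 , λ _ _ _ _ →
  subst (λ p → ∣ p ∣ ℚ.≤ ε) (sym (ℚₚ.+-inverseʳ q)) (ℚₚ.<⇒≤ 0<ε)

fromℤ : ℤ → ℝ
fromℤ n = fromℚ (n ℚ./ 1)

0ℝ 1ℝ : ℝ
0ℝ = fromℚ 0ℚ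
1ℝ = fromℚ 1ℚ

_+_ : ℝ → ℝ → ℝ
x + y = mkℝ (λ n → seq x n ℚ.+ seq y n) (+-cauchy {seq x} {seq y} (cauchy x) (cauchy y))

-_ : ℝ → ℝ
- x = mkℝ (λ n → ℚ.- seq x n) (neg-cauchy {seq x} (cauchy x))

_-_ : ℝ → ℝ → ℝ
x - y = x + (- y)

_*_ : ℝ → ℝ → ℝ
x * y = mkℝ (λ n → seq x n ℚ.* seq y n) (*-cauchy {seq x} {seq y} (cauchy x) (cauchy y))

_^_ : ℝ → ℕ → ℝ
x ^ zero  = 1ℝ
x ^ suc n = x * x ^ n

private
  0<⊔ : ∀ p {ε} → 0ℚ ℚ.< ε → 0ℚ ℚ.< p ℚ.⊔ ε
  0<⊔ p {ε} 0<ε = ℚₚ.<-≤-trans 0<ε (ℚₚ.p≤q⊔p p ε)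

  abstract
    inv-cauchy : ∀ {s ε} (0<ε : 0ℚ ℚ.< ε) {N} → (∀ n → N ℕ.≤ n → ε ℚ.+ 0ℚ ℚ.≤ s n) →
                 IsCauchy s → IsCauchy (λ n → rec (s n ℚ.⊔ ε) (0<⊔ (s n) 0<ε))
    inv-cauchy {s} {ε} 0<ε {N} ε≤s cs δ 0<δ =
      let M , h = cs ((ε ℚ.* ε) ℚ.* δ) (*-pos (*-pos 0<ε 0<ε) 0<δ)
      in N ℕ.⊔ M , λ m n m≥ n≥ →
      bound (s m ℚ.⊔ ε) (s n ℚ.⊔ ε) (0<⊔ (s m) 0<ε) (0<⊔ (s n) 0<ε) (ℚₚ.p≤q⊔p (s m) ε) (ℚₚ.p≤q⊔p (s n) ε)
        (subst₂ (λ a b → ∣ a ℚ.- b ∣ ℚ.≤ (ε ℚ.* ε) ℚ.* δ)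
          (sym (max (ε≤s n (ℕₚ.m⊔n≤o⇒m≤o N M n≥)))) (sym (max (ε≤s m (ℕₚ.m⊔n≤o⇒m≤o N M m≥))))
          (h n m (ℕₚ.m⊔n≤o⇒n≤o N M n≥) (ℕₚ.m⊔n≤o⇒n≤o N M m≥)))
      where
      open +-*-Solver

      max : ∀ {p} → ε ℚ.+ 0ℚ ℚ.≤ p → p ℚ.⊔ ε ≡ p
      max ε≤p = ℚₚ.p≥q⇒p⊔q≡p (subst (ℚ._≤ _) (ℚₚ.+-identityʳ ε) ε≤p)

      rec-≤ : ∀ {p} (0<p : 0ℚ ℚ.< p) → ε ℚ.≤ p → rec p 0<p ℚ.* ε ℚ.≤ 1ℚ
      rec-≤ {p} 0<p ε≤p = subst (rec p 0<p ℚ.* ε ℚ.≤_) (rec-inverse p 0<p)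
        (ℚₚ.*-monoˡ-≤-nonNeg (rec p 0<p) {{ℚ.nonNegative (ℚₚ.<⇒≤ (rec-pos p 0<p))}} ε≤p)

      expand : ∀ p q u v → (u ℚ.* v) ℚ.* (q ℚ.- p) ≡ (v ℚ.* q) ℚ.* u ℚ.- (u ℚ.* p) ℚ.* v
      expand = solve 4 (λ p q u v → (u :* v) :* (q :- p) := (v :* q) :* u :- (u :* p) :* v) refl

      regroup : ∀ u v e d → (u ℚ.* v) ℚ.* ((e ℚ.* e) ℚ.* d) ≡ ((u ℚ.* e) ℚ.* (v ℚ.* e)) ℚ.* d
      regroup = solve 4 (λ u v e d → (u :* v) :* ((e :* e) :* d) := ((u :* e) :* (v :* e)) :* d) refl

      bound : ∀ p q (0<p : 0ℚ ℚ.< p) (0<q : 0ℚ ℚ.< q) → ε ℚ.≤ p → ε ℚ.≤ q →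
              ∣ q ℚ.- p ∣ ℚ.≤ (ε ℚ.* ε) ℚ.* δ → ∣ rec p 0<p ℚ.- rec q 0<q ∣ ℚ.≤ δ
      bound p q 0<p 0<q ε≤p ε≤q h′ = begin
        ∣ u ℚ.- v ∣                            ≡⟨ cong ∣_∣ (cong₂ ℚ._-_ (one u (rec-inverse q 0<q)) (one v (rec-inverse p 0<p))) ⟨
        ∣ (v ℚ.* q) ℚ.* u ℚ.- (u ℚ.* p) ℚ.* v ∣ ≡⟨ cong ∣_∣ (expand p q u v) ⟨
        ∣ (u ℚ.* v) ℚ.* (q ℚ.- p) ∣            ≡⟨ ℚₚ.∣p*q∣≡∣p∣*∣q∣ (u ℚ.* v) (q ℚ.- p) ⟩
        ∣ u ℚ.* v ∣ ℚ.* ∣ q ℚ.- p ∣             ≡⟨ cong (ℚ._* ∣ q ℚ.- p ∣) (ℚₚ.0≤p⇒∣p∣≡p 0≤uv) ⟩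
        (u ℚ.* v) ℚ.* ∣ q ℚ.- p ∣               ≤⟨ ℚₚ.*-monoˡ-≤-nonNeg (u ℚ.* v) {{ℚ.nonNegative 0≤uv}} h′ ⟩
        (u ℚ.* v) ℚ.* ((ε ℚ.* ε) ℚ.* δ)         ≡⟨ regroup u v ε δ ⟩
        ((u ℚ.* ε) ℚ.* (v ℚ.* ε)) ℚ.* δ         ≤⟨ ℚₚ.*-monoʳ-≤-nonNeg δ {{ℚ.nonNegative (ℚₚ.<⇒≤ 0<δ)}}
                                                    (*-mono {q = 1ℚ} {s = 1ℚ} (ℚₚ.nonNegative⁻¹ 1ℚ)
                                                      (ℚₚ.<⇒≤ (*-pos (rec-pos q 0<q) 0<ε))
                                                      (rec-≤ 0<p ε≤p) (rec-≤ 0<q ε≤q)) ⟩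
        1ℚ ℚ.* δ                               ≡⟨ ℚₚ.*-identityˡ δ ⟩
        δ                                      ∎
        where
        open ℚₚ.≤-Reasoning
        u v : ℚ
        u = rec p 0<p
        v = rec q 0<q
        0≤uv : 0ℚ ℚ.≤ u ℚ.* v
        0≤uv = ℚₚ.<⇒≤ (*-pos (rec-pos p 0<p) (rec-pos q 0<q))
        one : ∀ w {r} → r ≡ 1ℚ → r ℚ.* w ≡ w
        one w refl = ℚₚ.*-identityˡ w

-- The reciprocal of a positive real. The terms are truncated below at the
-- bound ε that witnesses positivity, which changes only finitely many of them.
inv : (x : ℝ) → 0ℝ < x → ℝ
inv x (ε , 0<ε , N , ε≤x) = mkℝ
  (λ n → rec (seq x n ℚ.⊔ ε) (0<⊔ (seq x n) 0<ε))
  (inv-cauchy {seq x} 0<ε {N} ε≤x (cauchy x))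

-- ⌊_⌋ is not a computable function on ℝ, so it enters through its graph.
IsFloor : ℝ → ℤ → Set
IsFloor r n = fromℤ n ≤ r × r < fromℤ n + 1ℝ

1<⇒0< : ∀ {β} → 1ℝ < β → 0ℝ < β
1<⇒0< (ε , 0<ε , N , h) = ε , 0<ε , N , λ n n≥ →
  ℚₚ.≤-trans (ℚₚ.+-monoʳ-≤ ε (ℚₚ.nonNegative⁻¹ 1ℚ)) (h n n≥)

1<⇒0<+1 : ∀ {β} → 1ℝ < β → 0ℝ < β + 1ℝ
1<⇒0<+1 {β} 1<β =
  let ε , 0<ε , N , h = 1<⇒0< {β} 1<β in
  ε , 0<ε , N , λ n n≥ → ℚₚ.≤-trans (h n n≥)
  (subst (ℚ._≤ seq β n ℚ.+ 1ℚ) (ℚₚ.+-identityʳ (seq β n))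
    (ℚₚ.+-monoʳ-≤ (seq β n) (ℚₚ.nonNegative⁻¹ 1ℚ)))

module NegativeBase (β : ℝ) (1<β : 1ℝ < β) where

  ℓ : ℝ
  ℓ = (- β) * inv (β + 1ℝ) (1<⇒0<+1 {β} 1<β)

  _/[-β]^_ : ℝ → ℕ → ℝ
  x /[-β]^ k = x * (- inv β (1<⇒0< {β} 1<β)) ^ k

  InOpenInterval : ℝ → Set
  InOpenInterval x = ℓ < x × x < ℓ + 1ℝ

  -- d is the digit sequence d₋ᵦ(x) of x ∈ [ℓ,ℓ+1), with d i = xᵢ₊₁ and
  -- orbit i = T₋ᵦⁱ(x), where T₋ᵦ(t) = −βt − ⌊−βt − ℓ⌋.
  record IsDigitSequence (x : ℝ) (d : ℕ → ℤ) : Set where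
    field
      orbit       : ℕ → ℝ
      orbit-zero  : orbit 0 ≃ x
      digit-floor : ∀ i → IsFloor ((- β) * orbit i - ℓ) (d i)
      orbit-suc   : ∀ i → orbit (suc i) ≃ (- β) * orbit i - fromℤ (d i)

  -- The expansion x₁⋯xₖ • xₖ₊₁xₖ₊₂⋯ of an arbitrary real (0 • x₁x₂⋯ if k = 0).
  record Expansion (x : ℝ) : Set where
    field
      k         : ℕ
      inside    : InOpenInterval (x /[-β]^ k)
      k-minimal : ∀ j → j ℕ.< k → ¬ InOpenInterval (x /[-β]^ j)
      digit     : ℕ → ℤ
      isDigits  : IsDigitSequence (x /[-β]^ k) digit

    -- fractionalDigit j is the (j+1)-st digit after •.
    fractionalDigit : ℕ → ℤ
    fractionalDigit j = digit (k ℕ.+ j)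

  open Expansion using (fractionalDigit)

  ℤ₋ᵦ : ℝ → Set
  ℤ₋ᵦ x = Σ (Expansion x) λ e → ∀ j → fractionalDigit e j ≡ 0ℤ

  Fin₋ᵦ : ℝ → Set
  Fin₋ᵦ x = ∃ λ i → ∃ λ z → ℤ₋ᵦ z × x ≃ z /[-β]^ i

  -- The graph of fr, with values in ℕ ∪ {+∞}.
  data IsFr (x : ℝ) : ℕ ⁺ → Set where
    integral   : Fin₋ᵦ x → (e : Expansion x) →
                 (∀ j → fractionalDigit e j ≡ 0ℤ) → IsFr x [ 0 ]
    fractional : Fin₋ᵦ x → (e : Expansion x) → ∀ j →
                 fractionalDigit e j ≢ 0ℤ →
                 (∀ i → j ℕ.< i → fractionalDigit e i ≡ 0ℤ) → IsFr x [ suc j ]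
    infinite   : ¬ Fin₋ᵦ x → IsFr x ⊤⁺

  fr[_]≤_ : ℝ → ℕ → Set
  fr[ x ]≤ n = ∃ λ v → IsFr x v × v ≤⁺ [ n ]

IsTribonacciConstant : ℝ → Set
IsTribonacciConstant γ = γ ^ 3 - γ ^ 2 - γ - 1ℝ ≃ 0ℝ

abstract
  -- On rationals q < 5/4 the polynomial is at most −22/27, because
  -- q³ − q² − q − 1 = (q + 1/3)² (q − 5/3) − 22/27.
  tribonacci>1 : ∀ γ → IsTribonacciConstant γ → 1ℝ < γ
  tribonacci>1 γ root =
    let N , h = root ½ (ℚₚ.positive⁻¹ ½) in
    ¼ , ℚₚ.positive⁻¹ ¼ , N , λ n n≥ →
    ℚₚ.≮⇒≥ λ q< → ℚₚ.<-irrefl refl (ℚₚ.<-≤-trans (½<∣pol∣ {seq γ n} q<) (h n n≥))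
    where
    ¼ : ℚ
    ¼ = ½ ℚ.* ½

    third 5/3 22/27 : ℚ
    third = ℤ.+ 1 ℚ./ 3
    5/3   = ℤ.+ 5 ℚ./ 3
    22/27 = ℤ.+ 22 ℚ./ 27

    pol : ℚ → ℚ
    pol q = q ℚ.* (q ℚ.* (q ℚ.* 1ℚ)) ℚ.+ ℚ.- (q ℚ.* (q ℚ.* 1ℚ)) ℚ.+ ℚ.- q ℚ.+ ℚ.- 1ℚ ℚ.- 0ℚ

    -pol≡ : ∀ q → ℚ.- pol q ≡ (5/3 ℚ.- q) ℚ.* ((q ℚ.+ third) ℚ.* (q ℚ.+ third)) ℚ.+ 22/27
    -pol≡ = solve 1 (λ q →
        :- (q :* (q :* (q :* con 1ℚ)) :+ :- (q :* (q :* con 1ℚ)) :+ :- q :+ :- con 1ℚ :- con 0ℚ)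
        := (con 5/3 :- q) :* ((q :+ con third) :* (q :+ con third)) :+ con 22/27) refl
      where open +-*-Solver

    abs²≥0 : ∀ p → 0ℚ ℚ.≤ ∣ p ∣ ℚ.* ∣ p ∣
    abs²≥0 p = *-mono {p = 0ℚ} {r = 0ℚ} (ℚₚ.0≤∣p∣ p) ℚₚ.≤-refl (ℚₚ.0≤∣p∣ p) (ℚₚ.0≤∣p∣ p)

    neg² : ∀ p → (ℚ.- p) ℚ.* (ℚ.- p) ≡ p ℚ.* p
    neg² = solve 1 (λ a → (:- a) :* (:- a) := a :* a) refl
      where open +-*-Solver

    square≥0 : ∀ p → 0ℚ ℚ.≤ p ℚ.* p
    square≥0 p with ℚₚ.∣p∣≡p∨∣p∣≡-p p
    ... | inj₁ eq = subst (λ a → 0ℚ ℚ.≤ a ℚ.* a) eq (abs²≥0 p)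
    ... | inj₂ eq = subst (0ℚ ℚ.≤_) (neg² p) (subst (λ a → 0ℚ ℚ.≤ a ℚ.* a) eq (abs²≥0 p))

    p≤∣p∣ : ∀ p → p ℚ.≤ ∣ p ∣
    p≤∣p∣ p with ℚₚ.≤-total 0ℚ p
    ... | inj₁ 0≤p = ℚₚ.≤-reflexive (sym (ℚₚ.0≤p⇒∣p∣≡p 0≤p))
    ... | inj₂ p≤0 = ℚₚ.≤-trans p≤0 (ℚₚ.0≤∣p∣ p)

    ½<∣pol∣ : ∀ {q} → q ℚ.< ¼ ℚ.+ 1ℚ → ½ ℚ.< ∣ pol q ∣
    ½<∣pol∣ {q} q< = begin-strict
      ½                                    <⟨ toWitness {a? = ½ ℚₚ.<? 22/27} _ ⟩
      22/27                                ≡⟨ ℚₚ.+-identityˡ 22/27 ⟨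
      0ℚ ℚ.+ 22/27                         ≤⟨ ℚₚ.+-monoˡ-≤ 22/27 0≤prod ⟩
      (5/3 ℚ.- q) ℚ.* (r ℚ.* r) ℚ.+ 22/27  ≡⟨ -pol≡ q ⟨
      ℚ.- pol q                            ≤⟨ p≤∣p∣ (ℚ.- pol q) ⟩
      ∣ ℚ.- pol q ∣                        ≡⟨ ℚₚ.∣-p∣≡∣p∣ (pol q) ⟩
      ∣ pol q ∣                            ∎
      where
      open ℚₚ.≤-Reasoning
      r : ℚ
      r = q ℚ.+ third

      0≤5/3-q : 0ℚ ℚ.≤ 5/3 ℚ.- q
      0≤5/3-q = subst (ℚ._≤ 5/3 ℚ.- q) (ℚₚ.+-inverseʳ q) (ℚₚ.+-monoˡ-≤ (ℚ.- q)
        (ℚₚ.≤-trans (ℚₚ.<⇒≤ q<) (toWitness {a? = ¼ ℚ.+ 1ℚ ℚₚ.≤? 5/3} _)))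

      0≤prod : 0ℚ ℚ.≤ (5/3 ℚ.- q) ℚ.* (r ℚ.* r)
      0≤prod = *-mono {p = 0ℚ} {r = 0ℚ} 0≤5/3-q ℚₚ.≤-refl 0≤5/3-q (square≥0 r)

{-# OPTIONS --safe #-}
-- Since γ is a unit of ℤ[γ], all numbers with finite expansions lie in ℤ[γ].
-- Divide x, y and z = x + y by a power of −γ that brings them into (ℓ, ℓ+1) and
-- run T on all three. The difference s of the orbits of z, x and y stays in
-- (−ℓ−2, 1−ℓ) and moves by s ↦ −γ s − e with e ∈ {−2, …, 1}; starting from 0 it
-- meets only 30 elements of ℤ[γ]. Once the digits of x and y are used up, the
-- orbit of z is at such an s, and each s inside [ℓ, ℓ+1) reaches 0 within 6 steps.
-- For z = x − y the same automaton is read with x = z + y, which negates s.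
-- Comparisons with ℓ are decidable because (γ + 1)(t − ℓ) has odd norm for
-- t ∈ ℤ[γ], hence is bounded away from 0.
module Submission where

open import Defs

open import Algebra.Bundles using (CommutativeRing)
open import Data.Bool.Base using (Bool; true; false; _∧_; _∨_; T)
open import Data.Bool.Properties using (T-∧; T-∨; T?)
open import Data.Empty using (⊥; ⊥-elim)
open import Data.Integer.Base as ℤ using (ℤ; +_; -[1+_]; +[1+_]; 0ℤ; 1ℤ)
import Data.Integer.Properties as ℤₚ
import Data.Integer.Solver as ℤ-Solver
open import Data.List.Base using (List; []; _∷_)
import Data.List.Membership.DecPropositional as DecMembership
open import Data.List.Membership.Propositional using (_∈_)
open import Data.List.Relation.Unary.All as All using (All)
open import Data.List.Relation.Unary.Any using (here; there)
open import Data.Maybe.Base using (just; nothing)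
open import Data.Nat.Base as ℕ using (ℕ; zero; suc)
import Data.Nat.Properties as ℕₚ
open import Data.Product.Base using (Σ; ∃; _×_; _,_; proj₁; proj₂)
open import Data.Rational.Base as ℚ using (ℚ; 0ℚ; 1ℚ; ½; ∣_∣)
import Data.Rational.Properties as ℚₚ
import Data.Rational.Solver as ℚ-Solver
import Data.Rational.Unnormalised.Base as ℚᵘ
import Data.Rational.Unnormalised.Properties as ℚᵘₚ
open import Data.Sum.Base as Sum using (_⊎_; inj₁; inj₂)
open import Function.Bundles using (Equivalence)
open import Level using (0ℓ)
open import Relation.Binary.Construct.Add.Supremum.NonStrict ℕ._≤_ using ([_])
open import Relation.Binary.Definitions using (DecidableEquality)
open import Relation.Binary.PropositionalEquality
open import Relation.Nullary.Construct.Add.Supremum using ([_])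
open import Relation.Nullary.Decidable using (yes; no; ⌊_⌋; map′; toWitness; _×-dec_; _⊎-dec_)
open import Relation.Nullary.Negation using (¬_)
open import Tactic.RingSolver using (solve-∀)
open import Tactic.RingSolver.Core.AlmostCommutativeRing using (AlmostCommutativeRing; fromCommutativeRing)

-- Why finitely many states can be expected: the two other conjugates of `γ` have modulus
-- `γ^(-1/2) < 1`, so along `s ↦ −γ s − e` they keep the conjugates of `s` bounded, while the
-- interval bounds `s` itself; only finitely many elements of ℤ[γ] have all conjugates bounded. In
-- the code this finiteness is an explicit list whose closure is evaluated. The obstacle is that the
-- order on Cauchy reals is undecidable, whereas an expansion of `x ± y` has to be exhibited with
-- its digits and its minimal `k`. Comparisons are therefore made on integer triples and carried to
-- the reals along `≃`. The orbits of `x` and `y` are traced backwards into ℤ[γ]: the tail of zero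
-- digits is a bounded orbit under multiplication by `−γ`, hence sits at 0, and every earlier point
-- is recovered from its successor.

record Triple (A : Set) : Set where
  constructor ⟨_,_,_⟩
  field c₀ c₁ c₂ : A

open Triple

-- The triple `⟨ a , b , c ⟩` stands for `a + bγ + cγ²`. The carrier is abstract so that the same
-- formulas serve over ℤ, over ℚ and over the polynomial syntax of the ring solvers.
module TripleOperations {A : Set} (_+_ _*_ : A → A → A) (-_ : A → A) where

  infixl 6 _⊕_
  infixl 7 _⊗_
  infix  8 ⊝_

  _⊕_ _⊗_ : Triple A → Triple A → Triple A
  ⟨ a , b , c ⟩ ⊕ ⟨ a′ , b′ , c′ ⟩ = ⟨ a + a′ , b + b′ , c + c′ ⟩

  -- Reduction by `x³ = 1 + x + x²` and `x⁴ = 1 + 2x + 2x²`; the local names `x⁴` and `x³+x⁴` are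
  -- coefficients of the unreduced product.
  ⟨ a , b , c ⟩ ⊗ ⟨ a′ , b′ , c′ ⟩ =
    ⟨ (a * a′) + x³+x⁴
    , ((a * b′) + (b * a′)) + (x³+x⁴ + x⁴)
    , ((a * c′) + ((b * b′) + (c * a′))) + (x³+x⁴ + x⁴) ⟩
    where
    x⁴ x³+x⁴ : A
    x⁴    = c * c′
    x³+x⁴ = ((b * c′) + (c * b′)) + x⁴

  ⊝_ : Triple A → Triple A
  ⊝ ⟨ a , b , c ⟩ = ⟨ - a , - b , - c ⟩

  -- The cofactors of the first row in the matrix of multiplication by `t` on the basis `1, γ, γ²`;
  -- `norm` expands the determinant along that row.
  adjugate : Triple A → Triple A
  adjugate ⟨ a , b , c ⟩ =
    ⟨ ((a + c) * ((a + b) + (c + c))) + (- ((b + (c + c)) * (b + c)))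
    , ((b + (c + c)) * c) + (- (b * ((a + b) + (c + c))))
    , (b * (b + c)) + (- ((a + c) * c)) ⟩

  norm : Triple A → A
  norm t@(⟨ a , b , c ⟩) with adjugate t
  ... | ⟨ u , v , w ⟩ = ((a * u) + (c * v)) + ((b + c) * w)

ℤ[γ] : Set
ℤ[γ] = Triple ℤ

private module Z = TripleOperations ℤ._+_ ℤ._*_ (ℤ.-_)

infixl 6 _⊕_
infixl 7 _⊗_
infix  8 ⊝_

_⊕_ _⊗_ : ℤ[γ] → ℤ[γ] → ℤ[γ]
_⊕_ = Z._⊕_
_⊗_ = Z._⊗_

⊝_ : ℤ[γ] → ℤ[γ]
⊝_ = Z.⊝_

adjugate : ℤ[γ] → ℤ[γ]
adjugate = Z.adjugate

norm : ℤ[γ] → ℤ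
norm = Z.norm

κ : ℤ → ℤ[γ]
κ n = ⟨ n , 0ℤ , 0ℤ ⟩

γ̂ : ℤ[γ]
γ̂ = ⟨ 0ℤ , 1ℤ , 0ℤ ⟩

0̂ 1̂ : ℤ[γ]
0̂ = κ 0ℤ
1̂ = κ 1ℤ

-- lo t = (γ + 1)(t − ℓ) and hi t = (γ + 1)(ℓ + 1 − t), which lie in ℤ[γ] although
-- ℓ does not, since (γ + 1) ℓ = −γ.
lo hi : ℤ[γ] → ℤ[γ]
lo t = (γ̂ ⊕ 1̂) ⊗ t ⊕ γ̂
hi t = 1̂ ⊕ ⊝ ((γ̂ ⊕ 1̂) ⊗ t)

shift : ℤ[γ] → ℤ → ℤ[γ]
shift t d = ⊝ (γ̂ ⊗ t) ⊕ ⊝ κ d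

triple-cong : ∀ {A : Set} {a b c a′ b′ c′ : A} → a ≡ a′ → b ≡ b′ → c ≡ c′ →
              ⟨ a , b , c ⟩ ≡ ⟨ a′ , b′ , c′ ⟩
triple-cong refl refl refl = refl

-- ℤ[x]/(x³ − x² − x − 1) is a commutative ring

module ℤS = ℤ-Solver.+-*-Solver

module _ where

  open ℤS using (Polynomial; _:+_; _:*_; :-_; _:=_; con)
  private module P {n} = TripleOperations {Polynomial n} _:+_ _:*_ (:-_)

  ⊕-assoc : ∀ x y z → (x ⊕ y) ⊕ z ≡ x ⊕ (y ⊕ z)
  ⊕-assoc x y z = triple-cong
    (ℤₚ.+-assoc (c₀ x) (c₀ y) (c₀ z)) (ℤₚ.+-assoc (c₁ x) (c₁ y) (c₁ z)) (ℤₚ.+-assoc (c₂ x) (c₂ y) (c₂ z))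

  ⊕-comm : ∀ x y → x ⊕ y ≡ y ⊕ x
  ⊕-comm x y = triple-cong (ℤₚ.+-comm (c₀ x) (c₀ y)) (ℤₚ.+-comm (c₁ x) (c₁ y)) (ℤₚ.+-comm (c₂ x) (c₂ y))

  ⊕-identityˡ : ∀ x → κ 0ℤ ⊕ x ≡ x
  ⊕-identityˡ x = triple-cong (ℤₚ.+-identityˡ (c₀ x)) (ℤₚ.+-identityˡ (c₁ x)) (ℤₚ.+-identityˡ (c₂ x))

  ⊕-inverseˡ : ∀ x → ⊝ x ⊕ x ≡ κ 0ℤ
  ⊕-inverseˡ x = triple-cong (ℤₚ.+-inverseˡ (c₀ x)) (ℤₚ.+-inverseˡ (c₁ x)) (ℤₚ.+-inverseˡ (c₂ x))

  ⊗-assoc : ∀ x y z → (x ⊗ y) ⊗ z ≡ x ⊗ (y ⊗ z)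
  ⊗-assoc ⟨ a , b , c ⟩ ⟨ d , e , f ⟩ ⟨ g , h , i ⟩ = triple-cong
    (ℤS.solve 9 (λ a b c d e f g h i → c₀ ((⟨ a , b , c ⟩ P.⊗ ⟨ d , e , f ⟩) P.⊗ ⟨ g , h , i ⟩)
      := c₀ (⟨ a , b , c ⟩ P.⊗ (⟨ d , e , f ⟩ P.⊗ ⟨ g , h , i ⟩))) refl a b c d e f g h i)
    (ℤS.solve 9 (λ a b c d e f g h i → c₁ ((⟨ a , b , c ⟩ P.⊗ ⟨ d , e , f ⟩) P.⊗ ⟨ g , h , i ⟩)
      := c₁ (⟨ a , b , c ⟩ P.⊗ (⟨ d , e , f ⟩ P.⊗ ⟨ g , h , i ⟩))) refl a b c d e f g h i)
    (ℤS.solve 9 (λ a b c d e f g h i → c₂ ((⟨ a , b , c ⟩ P.⊗ ⟨ d , e , f ⟩) P.⊗ ⟨ g , h , i ⟩)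
      := c₂ (⟨ a , b , c ⟩ P.⊗ (⟨ d , e , f ⟩ P.⊗ ⟨ g , h , i ⟩))) refl a b c d e f g h i)

  ⊗-comm : ∀ x y → x ⊗ y ≡ y ⊗ x
  ⊗-comm ⟨ a , b , c ⟩ ⟨ d , e , f ⟩ = triple-cong
    (ℤS.solve 6 (λ a b c d e f → c₀ (⟨ a , b , c ⟩ P.⊗ ⟨ d , e , f ⟩)
      := c₀ (⟨ d , e , f ⟩ P.⊗ ⟨ a , b , c ⟩)) refl a b c d e f)
    (ℤS.solve 6 (λ a b c d e f → c₁ (⟨ a , b , c ⟩ P.⊗ ⟨ d , e , f ⟩)
      := c₁ (⟨ d , e , f ⟩ P.⊗ ⟨ a , b , c ⟩)) refl a b c d e f)
    (ℤS.solve 6 (λ a b c d e f → c₂ (⟨ a , b , c ⟩ P.⊗ ⟨ d , e , f ⟩)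
      := c₂ (⟨ d , e , f ⟩ P.⊗ ⟨ a , b , c ⟩)) refl a b c d e f)

  ⊗-distribˡ-⊕ : ∀ x y z → x ⊗ (y ⊕ z) ≡ (x ⊗ y) ⊕ (x ⊗ z)
  ⊗-distribˡ-⊕ ⟨ a , b , c ⟩ ⟨ d , e , f ⟩ ⟨ g , h , i ⟩ = triple-cong
    (ℤS.solve 9 (λ a b c d e f g h i → c₀ (⟨ a , b , c ⟩ P.⊗ (⟨ d , e , f ⟩ P.⊕ ⟨ g , h , i ⟩))
      := c₀ ((⟨ a , b , c ⟩ P.⊗ ⟨ d , e , f ⟩) P.⊕ (⟨ a , b , c ⟩ P.⊗ ⟨ g , h , i ⟩))) refl a b c d e f g h i)
    (ℤS.solve 9 (λ a b c d e f g h i → c₁ (⟨ a , b , c ⟩ P.⊗ (⟨ d , e , f ⟩ P.⊕ ⟨ g , h , i ⟩))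
      := c₁ ((⟨ a , b , c ⟩ P.⊗ ⟨ d , e , f ⟩) P.⊕ (⟨ a , b , c ⟩ P.⊗ ⟨ g , h , i ⟩))) refl a b c d e f g h i)
    (ℤS.solve 9 (λ a b c d e f g h i → c₂ (⟨ a , b , c ⟩ P.⊗ (⟨ d , e , f ⟩ P.⊕ ⟨ g , h , i ⟩))
      := c₂ ((⟨ a , b , c ⟩ P.⊗ ⟨ d , e , f ⟩) P.⊕ (⟨ a , b , c ⟩ P.⊗ ⟨ g , h , i ⟩))) refl a b c d e f g h i)

  ⊗-identityˡ : ∀ x → κ 1ℤ ⊗ x ≡ x
  ⊗-identityˡ ⟨ a , b , c ⟩ = triple-cong
    (ℤS.solve 3 (λ a b c → c₀ (⟨ con 1ℤ , con 0ℤ , con 0ℤ ⟩ P.⊗ ⟨ a , b , c ⟩)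
      := c₀ (⟨ a , b , c ⟩)) refl a b c)
    (ℤS.solve 3 (λ a b c → c₁ (⟨ con 1ℤ , con 0ℤ , con 0ℤ ⟩ P.⊗ ⟨ a , b , c ⟩)
      := c₁ (⟨ a , b , c ⟩)) refl a b c)
    (ℤS.solve 3 (λ a b c → c₂ (⟨ con 1ℤ , con 0ℤ , con 0ℤ ⟩ P.⊗ ⟨ a , b , c ⟩)
      := c₂ (⟨ a , b , c ⟩)) refl a b c)

  adjugate-⊗ : ∀ x → adjugate x ⊗ x ≡ κ (norm x)
  adjugate-⊗ ⟨ a , b , c ⟩ = triple-cong
    (ℤS.solve 3 (λ a b c → c₀ (P.adjugate ⟨ a , b , c ⟩ P.⊗ ⟨ a , b , c ⟩)
      := P.norm ⟨ a , b , c ⟩) refl a b c)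
    (ℤS.solve 3 (λ a b c → c₁ (P.adjugate ⟨ a , b , c ⟩ P.⊗ ⟨ a , b , c ⟩)
      := con 0ℤ) refl a b c)
    (ℤS.solve 3 (λ a b c → c₂ (P.adjugate ⟨ a , b , c ⟩ P.⊗ ⟨ a , b , c ⟩)
      := con 0ℤ) refl a b c)

  -- The norm of lo t is odd because lo t ≡ 1 modulo the prime γ + 1 above 2.
  half-norm : ℤ[γ] → ℤ
  half-norm ⟨ a , b , c ⟩ =
    let m = a ℤ.+ b ℤ.+ c ℤ.+ c
        x = a ℤ.+ c
        y = a ℤ.+ b ℤ.+ c ℤ.+ 1ℤ
        z = b ℤ.+ c ℤ.+ c in
    m ℤ.* (+ 4 ℤ.* m ℤ.* m ℤ.+ + 6 ℤ.* m ℤ.+ + 3)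
      ℤ.- (x ℤ.* x ℤ.* y ℤ.+ + 5 ℤ.* x ℤ.* y ℤ.* z ℤ.+ + 2 ℤ.* x ℤ.* z ℤ.* z ℤ.+ + 2 ℤ.* x ℤ.* y ℤ.* y
           ℤ.+ y ℤ.* y ℤ.* z ℤ.+ + 2 ℤ.* y ℤ.* z ℤ.* z)

  -- In `half-norm`, `x`, `y`, `z` are the coordinates of `lo t`, with sum `2m + 1`. The norm is
  -- `(x + y + z)³` minus twice the mixed form in the last two lines, and
  -- `(2m + 1)³ = 2 m (4m² + 6m + 3) + 1`.
  norm-odd : ∀ t → norm (lo t) ≡ half-norm t ℤ.+ half-norm t ℤ.+ 1ℤ
  norm-odd ⟨ a , b , c ⟩ = ℤS.solve 3 (λ a b c →
    let m = a :+ b :+ c :+ c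
        x = a :+ c
        y = a :+ b :+ c :+ con 1ℤ
        z = b :+ c :+ c
        k = m :* (con (+ 4) :* m :* m :+ con (+ 6) :* m :+ con (+ 3))
          ℤS.:- (x :* x :* y :+ con (+ 5) :* x :* y :* z :+ con (+ 2) :* x :* z :* z :+ con (+ 2) :* x :* y :* y
               :+ y :* y :* z :+ con (+ 2) :* y :* z :* z) in
    P.norm ((⟨ con 1ℤ , con 1ℤ , con 0ℤ ⟩ P.⊗ ⟨ a , b , c ⟩) P.⊕ ⟨ con 0ℤ , con 1ℤ , con 0ℤ ⟩)
      := k :+ k :+ con 1ℤ) refl a b c

  odd≢0 : ∀ k → k ℤ.+ k ℤ.+ 1ℤ ≢ 0ℤ
  odd≢0 (+ zero) ()
  odd≢0 (+ suc n) ()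
  odd≢0 -[1+ n ] ()

ℤ[γ]-commutativeRing : CommutativeRing 0ℓ 0ℓ
ℤ[γ]-commutativeRing = record
  { Carrier = ℤ[γ] ; _≈_ = _≡_ ; _+_ = _⊕_ ; _*_ = _⊗_ ; -_ = ⊝_ ; 0# = κ 0ℤ ; 1# = κ 1ℤ
  ; isCommutativeRing = record
    { isRing = record
      { +-isAbelianGroup = record
        { isGroup = record
          { isMonoid = record
            { isSemigroup = record
              { isMagma = record { isEquivalence = isEquivalence ; ∙-cong = cong₂ _⊕_ }
              ; assoc = ⊕-assoc }
            ; identity = ⊕-identityˡ , λ x → trans (⊕-comm x (κ 0ℤ)) (⊕-identityˡ x) }
          ; inverse = ⊕-inverseˡ , λ x → trans (⊕-comm x (⊝ x)) (⊕-inverseˡ x)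
          ; ⁻¹-cong = cong ⊝_ }
        ; comm = ⊕-comm }
      ; *-cong = cong₂ _⊗_
      ; *-assoc = ⊗-assoc
      ; *-identity = ⊗-identityˡ , λ x → trans (⊗-comm x (κ 1ℤ)) (⊗-identityˡ x)
      ; distrib = ⊗-distribˡ-⊕ , λ x y z → trans (⊗-comm (y ⊕ z) x)
          (trans (⊗-distribˡ-⊕ x y z) (cong₂ _⊕_ (⊗-comm x y) (⊗-comm x z))) }
    ; *-comm = ⊗-comm } }

-- Closed elements act as coefficients of the solver, so relations such as `γ̂ ⊗ γ̂⁻¹ = 1̂` are
-- settled by computation. The zero test has only to recognise the literal zero triple.
ℤ[γ]-ring : AlmostCommutativeRing 0ℓ 0ℓ
ℤ[γ]-ring = fromCommutativeRing ℤ[γ]-commutativeRing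
  λ { ⟨ ℤ.+0 , ℤ.+0 , ℤ.+0 ⟩ → just refl ; _ → nothing }

open ℚ-Solver.+-*-Solver using (solve; _:+_; _:*_; _:-_; :-_; _:=_; con)

-- Rational inequalities

-- Reduces linear arithmetic to the ring solver: the hypotheses are summed into one inequality, and
-- what remains is an identity between differences.
≤-by : ∀ {p q r s} → p ℚ.≤ q → q ℚ.- p ≡ s ℚ.- r → r ℚ.≤ s
≤-by {p} {q} {r} {s} p≤q eq = subst₂ ℚ._≤_ (ℚₚ.+-identityˡ r) (cancel s r)
  (ℚₚ.+-monoˡ-≤ r (subst₂ ℚ._≤_ (ℚₚ.+-inverseʳ p) eq (ℚₚ.+-monoˡ-≤ (ℚ.- p) p≤q)))
  where
  cancel : ∀ s r → s ℚ.- r ℚ.+ r ≡ s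
  cancel = solve 2 (λ s r → s :- r :+ r := s) refl

*-pos : ∀ {p q} → 0ℚ ℚ.< p → 0ℚ ℚ.< q → 0ℚ ℚ.< p ℚ.* q
*-pos {p} {q} 0<p 0<q = subst (ℚ._< p ℚ.* q) (ℚₚ.*-zeroʳ p) (ℚₚ.*-monoʳ-<-pos p {{ℚ.positive 0<p}} 0<q)

*-mono : ∀ {p q r s} → 0ℚ ℚ.≤ q → 0ℚ ℚ.≤ r → p ℚ.≤ q → r ℚ.≤ s → p ℚ.* r ℚ.≤ q ℚ.* s
*-mono {p} {q} {r} {s} 0≤q 0≤r p≤q r≤s = ℚₚ.≤-trans
  (ℚₚ.*-monoʳ-≤-nonNeg r {{ℚ.nonNegative 0≤r}} p≤q)
  (ℚₚ.*-monoˡ-≤-nonNeg q {{ℚ.nonNegative 0≤q}} r≤s)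

½ε>0 : ∀ {ε} → 0ℚ ℚ.< ε → 0ℚ ℚ.< ½ ℚ.* ε
½ε>0 = *-pos (ℚₚ.positive⁻¹ ½)

½ε+½ε≡ε : ∀ ε → ½ ℚ.* ε ℚ.+ ½ ℚ.* ε ≡ ε
½ε+½ε≡ε = solve 1 (λ e → con ½ :* e :+ con ½ :* e := e) refl

p≤∣p∣ : ∀ p → p ℚ.≤ ∣ p ∣
p≤∣p∣ p with ℚₚ.≤-total 0ℚ p
... | inj₁ 0≤p = ℚₚ.≤-reflexive (sym (ℚₚ.0≤p⇒∣p∣≡p 0≤p))
... | inj₂ p≤0 = ℚₚ.≤-trans p≤0 (ℚₚ.0≤∣p∣ p)

-p≤∣p∣ : ∀ p → ℚ.- p ℚ.≤ ∣ p ∣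
-p≤∣p∣ p = subst (ℚ.- p ℚ.≤_) (ℚₚ.∣-p∣≡∣p∣ p) (p≤∣p∣ (ℚ.- p))

p≤0⇒∣p∣≡-p : ∀ {p} → p ℚ.≤ 0ℚ → ∣ p ∣ ≡ ℚ.- p
p≤0⇒∣p∣≡-p {p} p≤0 = trans (sym (ℚₚ.∣-p∣≡∣p∣ p)) (ℚₚ.0≤p⇒∣p∣≡p (ℚₚ.neg-antimono-≤ p≤0))

∣p∣≤ : ∀ {p B} → p ℚ.≤ B → ℚ.- p ℚ.≤ B → ∣ p ∣ ℚ.≤ B
∣p∣≤ {p} h₁ h₂ with ℚₚ.∣p∣≡p∨∣p∣≡-p p
... | inj₁ eq = subst (ℚ._≤ _) (sym eq) h₁
... | inj₂ eq = subst (ℚ._≤ _) (sym eq) h₂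

reciprocal : ∀ {p} → 0ℚ ℚ.< p → ∃ λ r → 0ℚ ℚ.< r × p ℚ.* r ≡ 1ℚ
reciprocal {p} 0<p = ℚ.1/ p , ℚₚ.positive⁻¹ (ℚ.1/ p) {{ℚₚ.1/pos⇒pos p}} , ℚₚ.*-inverseʳ p
  where
  instance
    p-pos : ℚ.Positive p
    p-pos = ℚ.positive 0<p
    p-nonZero : ℚ.NonZero p
    p-nonZero = ℚₚ.pos⇒nonZero p

-- Null sequences and eventually positive sequences

Seq : Set
Seq = ℕ → ℚ

Eventually : (ℕ → Set) → Set
Eventually P = ∃ λ N → ∀ n → N ℕ.≤ n → P n

eventually-map : ∀ {P Q : ℕ → Set} → (∀ n → P n → Q n) → Eventually P → Eventually Q
eventually-map f (N , h) = N , λ n n≥ → f n (h n n≥)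

eventually-zip : ∀ {P Q R : ℕ → Set} → (∀ n → P n → Q n → R n) →
                 Eventually P → Eventually Q → Eventually R
eventually-zip f (M , g) (N , h) = M ℕ.⊔ N , λ n n≥ →
  f n (g n (ℕₚ.m⊔n≤o⇒m≤o M N n≥)) (h n (ℕₚ.m⊔n≤o⇒n≤o M N n≥))

-- `x ≃ y` unfolds to `Null` of the termwise difference, so lemmas on null sequences apply to
-- equalities of reals directly.
Null Bounded Positive : Seq → Set
Null s     = ∀ ε → 0ℚ ℚ.< ε → Eventually λ n → ∣ s n ∣ ℚ.≤ ε
Bounded s  = ∃ λ B → 0ℚ ℚ.< B × Eventually λ n → ∣ s n ∣ ℚ.≤ B
Positive s = ∃ λ ε → 0ℚ ℚ.< ε × Eventually λ n → ε ℚ.≤ s n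

null-resp : ∀ {s t} → (∀ n → s n ≡ t n) → Null s → Null t
null-resp eq h ε 0<ε = eventually-map (λ n → subst (λ p → ∣ p ∣ ℚ.≤ ε) (eq n)) (h ε 0<ε)

null-0 : ∀ {s} → (∀ n → s n ≡ 0ℚ) → Null s
null-0 eq ε 0<ε = 0 , λ n _ → subst (λ p → ∣ p ∣ ℚ.≤ ε) (sym (eq n)) (ℚₚ.<⇒≤ 0<ε)

null-swap : ∀ {s t : Seq} → Null (λ n → s n ℚ.- t n) → Null (λ n → t n ℚ.- s n)
null-swap {s} {t} h ε 0<ε = eventually-map (λ n → subst (ℚ._≤ ε)
  (trans (sym (ℚₚ.∣-p∣≡∣p∣ (s n ℚ.- t n))) (cong ∣_∣ (eq (s n) (t n))))) (h ε 0<ε)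
  where
  eq : ∀ s t → ℚ.- (s ℚ.- t) ≡ t ℚ.- s
  eq = solve 2 (λ s t → :- (s :- t) := t :- s) refl

null-+ : ∀ {s t} → Null s → Null t → Null (λ n → s n ℚ.+ t n)
null-+ {s} {t} hs ht ε 0<ε = eventually-zip
  (λ n hn kn → subst (∣ s n ℚ.+ t n ∣ ℚ.≤_) (½ε+½ε≡ε ε)
    (ℚₚ.≤-trans (ℚₚ.∣p+q∣≤∣p∣+∣q∣ (s n) (t n)) (ℚₚ.+-mono-≤ hn kn)))
  (hs (½ ℚ.* ε) (½ε>0 0<ε)) (ht (½ ℚ.* ε) (½ε>0 0<ε))

null-* : ∀ {s t} → Bounded s → Null t → Null (λ n → s n ℚ.* t n)
null-* {s} {t} (B , 0<B , hs) ht ε 0<ε =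
  let r , 0<r , Br≡1 = reciprocal 0<B in
  eventually-zip
    (λ n hn kn → subst₂ ℚ._≤_ (sym (ℚₚ.∣p*q∣≡∣p∣*∣q∣ (s n) (t n)))
      (trans (sym (ℚₚ.*-assoc B r ε)) (trans (cong (ℚ._* ε) Br≡1) (ℚₚ.*-identityˡ ε)))
      (*-mono (ℚₚ.<⇒≤ 0<B) (ℚₚ.0≤∣p∣ (t n)) hn kn))
    hs (ht (r ℚ.* ε) (*-pos 0<r 0<ε))

cauchy⇒bounded : ∀ {s} → IsCauchy s → Bounded s
cauchy⇒bounded {s} c with c 1ℚ (ℚₚ.positive⁻¹ 1ℚ)
... | N , h = 1ℚ ℚ.+ ∣ s N ∣ , ℚₚ.+-mono-<-≤ (ℚₚ.positive⁻¹ 1ℚ) (ℚₚ.0≤∣p∣ (s N)) , N , λ n n≥ →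
  ℚₚ.≤-trans
    (subst (ℚ._≤ ∣ s n ℚ.- s N ∣ ℚ.+ ∣ s N ∣) (cong ∣_∣ (cancel (s n) (s N)))
      (ℚₚ.∣p+q∣≤∣p∣+∣q∣ (s n ℚ.- s N) (s N)))
    (ℚₚ.+-monoˡ-≤ ∣ s N ∣ (h n N n≥ ℕₚ.≤-refl))
  where
  cancel : ∀ a b → (a ℚ.- b) ℚ.+ b ≡ a
  cancel = solve 2 (λ a b → (a :- b) :+ b := a) refl

bounded : ∀ x → Bounded (seq x)
bounded x = cauchy⇒bounded {seq x} (cauchy x)

positive-resp-null : ∀ {s t} → Null (λ n → s n ℚ.- t n) → Positive s → Positive t
positive-resp-null {s} {t} null (ε , 0<ε , h) = ½ ℚ.* ε , ½ε>0 0<ε , eventually-zip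
  (λ n ε≤s s-t≤ → ≤-by (ℚₚ.+-mono-≤ ε≤s (ℚₚ.≤-trans (p≤∣p∣ (s n ℚ.- t n)) s-t≤)) (eq (s n) (t n) ε))
  h (null (½ ℚ.* ε) (½ε>0 0<ε))
  where
  eq : ∀ s t e → s ℚ.+ ½ ℚ.* e ℚ.- (e ℚ.+ (s ℚ.- t)) ≡ t ℚ.- ½ ℚ.* e
  eq = solve 3 (λ s t e → s :+ con ½ :* e :- (e :+ (s :- t)) := t :- con ½ :* e) refl

positive-resp : ∀ {s t} → (∀ n → s n ≡ t n) → Positive s → Positive t
positive-resp eq (ε , 0<ε , h) = ε , 0<ε , eventually-map (λ n → subst (ε ℚ.≤_) (eq n)) h

positive-+ : ∀ {s t} → Positive s → Positive t → Positive (λ n → s n ℚ.+ t n)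
positive-+ (ε , 0<ε , hs) (δ , 0<δ , ht) =
  ε ℚ.+ δ , ℚₚ.+-mono-< 0<ε 0<δ , eventually-zip (λ _ → ℚₚ.+-mono-≤) hs ht

positive-* : ∀ {s t} → Positive s → Positive t → Positive (λ n → s n ℚ.* t n)
positive-* (ε , 0<ε , hs) (δ , 0<δ , ht) = ε ℚ.* δ , *-pos 0<ε 0<δ , eventually-zip
  (λ n ε≤s δ≤t → *-mono (ℚₚ.≤-trans (ℚₚ.<⇒≤ 0<ε) ε≤s) (ℚₚ.<⇒≤ 0<δ) ε≤s δ≤t) hs ht

positive-asym : ∀ {s} → Positive s → Positive (λ n → ℚ.- s n) → ⊥
positive-asym {s} p q with positive-+ p q
... | ε , 0<ε , N , h = ℚₚ.<-irrefl refl
  (ℚₚ.<-≤-trans 0<ε (subst (ε ℚ.≤_) (ℚₚ.+-inverseʳ (s N)) (h N ℕₚ.≤-refl)))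

≥-of-product : ∀ {p q B r ε} → 0ℚ ℚ.< r → B ℚ.* r ≡ 1ℚ → ∣ p ∣ ℚ.≤ B →
               ε ℚ.≤ ∣ p ∣ ℚ.* ∣ q ∣ → r ℚ.* ε ℚ.≤ ∣ q ∣
≥-of-product {p} {q} {B} {r} {ε} 0<r Br≡1 p≤B ε≤ = subst (r ℚ.* ε ℚ.≤_) eq
  (ℚₚ.*-monoˡ-≤-nonNeg r {{ℚ.nonNegative (ℚₚ.<⇒≤ 0<r)}}
    (ℚₚ.≤-trans ε≤ (ℚₚ.*-monoʳ-≤-nonNeg ∣ q ∣ {{ℚ.nonNegative (ℚₚ.0≤∣p∣ q)}} p≤B)))
  where
  eq : r ℚ.* (B ℚ.* ∣ q ∣) ≡ ∣ q ∣
  eq = trans (solve 3 (λ r B q → r :* (B :* q) := (B :* r) :* q) refl r B ∣ q ∣)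
    (trans (cong (ℚ._* ∣ q ∣) Br≡1) (ℚₚ.*-identityˡ ∣ q ∣))

-- A term `t n ≤ 0` would make the product nonpositive; otherwise `t n ≥ ε / B`, uniformly in `n`
-- thanks to the bound `B` on `s`.
positive-*-cancelˡ : ∀ {s t} → Bounded s → Positive s → Positive (λ n → s n ℚ.* t n) → Positive t
positive-*-cancelˡ {s} {t} (B , 0<B , s≤B) (δ , 0<δ , δ≤s) (ε , 0<ε , ε≤st) =
  let r , 0<r , Br≡1 = reciprocal 0<B in
  r ℚ.* ε , *-pos 0<r 0<ε , eventually-zip (λ n → bound n 0<r Br≡1) s≤B (eventually-zip (λ _ → _,_) δ≤s ε≤st)
  where
  bound : ∀ n {r} → 0ℚ ℚ.< r → B ℚ.* r ≡ 1ℚ → ∣ s n ∣ ℚ.≤ B →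
          δ ℚ.≤ s n × ε ℚ.≤ s n ℚ.* t n → r ℚ.* ε ℚ.≤ t n
  bound n {r} 0<r Br≡1 s≤B (δ≤s , ε≤st) with ℚₚ.≤-total 0ℚ (t n)
  ... | inj₁ 0≤t = subst (r ℚ.* ε ℚ.≤_) (ℚₚ.0≤p⇒∣p∣≡p 0≤t) (≥-of-product {s n} {t n} 0<r Br≡1 s≤B
    (subst (ε ℚ.≤_) (ℚₚ.∣p*q∣≡∣p∣*∣q∣ (s n) (t n)) (ℚₚ.≤-trans ε≤st (p≤∣p∣ (s n ℚ.* t n)))))
  ... | inj₂ t≤0 = ⊥-elim (ℚₚ.<-irrefl refl (ℚₚ.<-≤-trans 0<ε (ℚₚ.≤-trans ε≤st
    (subst (s n ℚ.* t n ℚ.≤_) (ℚₚ.*-zeroʳ (s n))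
      (ℚₚ.*-monoˡ-≤-nonNeg (s n) {{ℚ.nonNegative (ℚₚ.≤-trans (ℚₚ.<⇒≤ 0<δ) δ≤s)}} t≤0)))))

-- Once the terms vary by at most `δ/2` while staying at distance `δ` from 0, the sign of a single
-- rational term decides all later ones.
cauchy-sign : ∀ {s} → IsCauchy s → Positive (λ n → ∣ s n ∣) → Positive s ⊎ Positive (λ n → ℚ.- s n)
cauchy-sign {s} c (δ , 0<δ , M , δ≤∣s∣) with c (½ ℚ.* δ) (½ε>0 0<δ)
... | N , h with ℚₚ.≤-total 0ℚ (s (M ℕ.⊔ N))
... | inj₁ 0≤s = inj₁ (½ ℚ.* δ , ½ε>0 0<δ , N , λ n n≥ →
      ≤-by (ℚₚ.+-mono-≤ (subst (δ ℚ.≤_) (ℚₚ.0≤p⇒∣p∣≡p 0≤s) (δ≤∣s∣ K (ℕₚ.m≤m⊔n M N)))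
        (ℚₚ.≤-trans (p≤∣p∣ (s K ℚ.- s n)) (h K n (ℕₚ.m≤n⊔m M N) n≥))) (eq (s K) (s n) δ))
  where
  K = M ℕ.⊔ N
  eq : ∀ s t e → s ℚ.+ ½ ℚ.* e ℚ.- (e ℚ.+ (s ℚ.- t)) ≡ t ℚ.- ½ ℚ.* e
  eq = solve 3 (λ s t e → s :+ con ½ :* e :- (e :+ (s :- t)) := t :- con ½ :* e) refl
... | inj₂ s≤0 = inj₂ (½ ℚ.* δ , ½ε>0 0<δ , N , λ n n≥ →
      ≤-by (ℚₚ.+-mono-≤ (subst (δ ℚ.≤_) (p≤0⇒∣p∣≡-p s≤0) (δ≤∣s∣ K (ℕₚ.m≤m⊔n M N)))
        (ℚₚ.≤-trans (-p≤∣p∣ (s K ℚ.- s n)) (h K n (ℕₚ.m≤n⊔m M N) n≥))) (eq (s K) (s n) δ))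
  where
  K = M ℕ.⊔ N
  eq : ∀ s t e → ℚ.- s ℚ.+ ½ ℚ.* e ℚ.- (e ℚ.+ ℚ.- (s ℚ.- t)) ≡ ℚ.- t ℚ.- ½ ℚ.* e
  eq = solve 3 (λ s t e → :- s :+ con ½ :* e :- (e :+ :- (s :- t)) := :- t :- con ½ :* e) refl

-- Eventually `|t s| ≥ 1/2` because `t s` tends to `m`, so `|s| ≥ 1/(2B)`. In the application `s` is
-- an element of ℤ[γ], `t` its adjugate and `m` its norm.
apart-of-product : ∀ {s t : Seq} {m} → Bounded t → Null (λ n → m ℚ.- t n ℚ.* s n) → 1ℚ ℚ.≤ ∣ m ∣ →
                   Positive (λ n → ∣ s n ∣)
apart-of-product {s} {t} {m} (B , 0<B , t≤B) null 1≤∣m∣ =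
  let r , 0<r , Br≡1 = reciprocal 0<B in
  r ℚ.* ½ , *-pos 0<r (ℚₚ.positive⁻¹ ½) , eventually-zip
    (λ n t≤B m-ts≤ → ≥-of-product {t n} {s n} 0<r Br≡1 t≤B (subst (½ ℚ.≤_) (ℚₚ.∣p*q∣≡∣p∣*∣q∣ (t n) (s n))
      (≤-by (ℚₚ.+-mono-≤ 1≤∣m∣ (ℚₚ.+-mono-≤ (triangle (t n ℚ.* s n)) m-ts≤))
        (eq ∣ m ∣ (∣ m ℚ.- t n ℚ.* s n ∣) (∣ t n ℚ.* s n ∣)))))
    t≤B (null ½ (ℚₚ.positive⁻¹ ½))
  where
  triangle : ∀ p → ∣ m ∣ ℚ.≤ ∣ m ℚ.- p ∣ ℚ.+ ∣ p ∣
  triangle p = subst (λ q → ∣ q ∣ ℚ.≤ ∣ m ℚ.- p ∣ ℚ.+ ∣ p ∣)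
    (solve 2 (λ m p → (m :- p) :+ p := m) refl m p) (ℚₚ.∣p+q∣≤∣p∣+∣q∣ (m ℚ.- p) p)
  eq : ∀ m d p → m ℚ.+ ((d ℚ.+ p) ℚ.+ ½) ℚ.- (1ℚ ℚ.+ (m ℚ.+ d)) ≡ p ℚ.- ½
  eq = solve 3 (λ m d p → m :+ ((d :+ p) :+ con ½) :- (con 1ℚ :+ (m :+ d)) := p :- con ½) refl

-- Evaluation of ℤ[γ]

ι : ℤ → ℚ
ι n = n ℚ./ 1

toℚᵘ-ι : ∀ n → ℚ.toℚᵘ (ι n) ℚᵘ.≃ ℚᵘ.mkℚᵘ n 0
toℚᵘ-ι n = ℚₚ.toℚᵘ-fromℚᵘ (ℚᵘ.mkℚᵘ n 0)

ι-+ : ∀ m n → ι (m ℤ.+ n) ≡ ι m ℚ.+ ι n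
ι-+ m n = ℚₚ.toℚᵘ-injective (begin
  ℚ.toℚᵘ (ι (m ℤ.+ n))               ≈⟨ toℚᵘ-ι (m ℤ.+ n) ⟩
  ℚᵘ.mkℚᵘ (m ℤ.+ n) 0                ≈⟨ ℚᵘ.*≡* (eq m n) ⟩
  ℚᵘ.mkℚᵘ m 0 ℚᵘ.+ ℚᵘ.mkℚᵘ n 0        ≈⟨ ℚᵘₚ.+-cong (toℚᵘ-ι m) (toℚᵘ-ι n) ⟨
  ℚ.toℚᵘ (ι m) ℚᵘ.+ ℚ.toℚᵘ (ι n)      ≈⟨ ℚₚ.toℚᵘ-homo-+ (ι m) (ι n) ⟨
  ℚ.toℚᵘ (ι m ℚ.+ ι n)               ∎)
  where
  open ℚᵘₚ.≃-Reasoning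
  eq : ∀ m n → (m ℤ.+ n) ℤ.* 1ℤ ≡ (m ℤ.* 1ℤ ℤ.+ n ℤ.* 1ℤ) ℤ.* 1ℤ
  eq m n = cong (ℤ._* 1ℤ) (sym (cong₂ ℤ._+_ (ℤₚ.*-identityʳ m) (ℤₚ.*-identityʳ n)))

ι-* : ∀ m n → ι (m ℤ.* n) ≡ ι m ℚ.* ι n
ι-* m n = ℚₚ.toℚᵘ-injective (begin
  ℚ.toℚᵘ (ι (m ℤ.* n))               ≈⟨ toℚᵘ-ι (m ℤ.* n) ⟩
  ℚᵘ.mkℚᵘ m 0 ℚᵘ.* ℚᵘ.mkℚᵘ n 0        ≈⟨ ℚᵘₚ.*-cong (toℚᵘ-ι m) (toℚᵘ-ι n) ⟨
  ℚ.toℚᵘ (ι m) ℚᵘ.* ℚ.toℚᵘ (ι n)      ≈⟨ ℚₚ.toℚᵘ-homo-* (ι m) (ι n) ⟨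
  ℚ.toℚᵘ (ι m ℚ.* ι n)               ∎)
  where open ℚᵘₚ.≃-Reasoning

ι-neg : ∀ n → ι (ℤ.- n) ≡ ℚ.- ι n
ι-neg n = ℚₚ.toℚᵘ-injective (begin
  ℚ.toℚᵘ (ι (ℤ.- n))                 ≈⟨ toℚᵘ-ι (ℤ.- n) ⟩
  ℚᵘ.- ℚᵘ.mkℚᵘ n 0                   ≈⟨ ℚᵘₚ.-‿cong (toℚᵘ-ι n) ⟨
  ℚᵘ.- ℚ.toℚᵘ (ι n)                  ≈⟨ ℚₚ.toℚᵘ-homo‿- (ι n) ⟨
  ℚ.toℚᵘ (ℚ.- ι n)                   ∎)
  where open ℚᵘₚ.≃-Reasoning

0≤ι : ∀ n → 0ℚ ℚ.≤ ι (+ n)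
0≤ι n = ℚₚ.nonNegative⁻¹ (ι (+ n)) {{ℚₚ.normalize-nonNeg n 1}}

1≤ι : ∀ n → 1ℚ ℚ.≤ ι +[1+ n ]
1≤ι n = subst (1ℚ ℚ.≤_) (sym (ι-+ 1ℤ (+ n))) (ℚₚ.+-mono-≤ {1ℚ} ℚₚ.≤-refl (0≤ι n))

1≤∣ι∣ : ∀ {n} → n ≢ 0ℤ → 1ℚ ℚ.≤ ∣ ι n ∣
1≤∣ι∣ {ℤ.+0}    n≢0 = ⊥-elim (n≢0 refl)
1≤∣ι∣ {+[1+ n ]} _ = ℚₚ.≤-trans (1≤ι n) (p≤∣p∣ (ι +[1+ n ]))
1≤∣ι∣ { -[1+ n ]} _ = subst (1ℚ ℚ.≤_) (trans (sym (ℚₚ.∣-p∣≡∣p∣ (ι +[1+ n ]))) (cong ∣_∣ (sym (ι-neg +[1+ n ]))))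
  (ℚₚ.≤-trans (1≤ι n) (p≤∣p∣ (ι +[1+ n ])))

ι³ : ℤ[γ] → Triple ℚ
ι³ ⟨ a , b , c ⟩ = ⟨ ι a , ι b , ι c ⟩

evalℚ : Triple ℚ → ℚ → ℚ
evalℚ ⟨ a , b , c ⟩ q = a ℚ.+ (b ℚ.* q ℚ.+ c ℚ.* (q ℚ.* q))

eval : ℤ[γ] → ℚ → ℚ
eval t = evalℚ (ι³ t)

eval-κ : ∀ n q → eval (κ n) q ≡ ι n
eval-κ n = l (ι n)
  where
  l : ∀ a q → a ℚ.+ (0ℚ ℚ.* q ℚ.+ 0ℚ ℚ.* (q ℚ.* q)) ≡ a
  l = solve 2 (λ a q → a :+ (con 0ℚ :* q :+ con 0ℚ :* (q :* q)) := a) refl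

eval-⊕ : ∀ x y q → eval (x ⊕ y) q ≡ eval x q ℚ.+ eval y q
eval-⊕ x@(⟨ a , b , c ⟩) y@(⟨ d , e , f ⟩) q =
  trans (cong (λ t → evalℚ t q) (triple-cong (ι-+ a d) (ι-+ b e) (ι-+ c f)))
        (l (ι a) (ι b) (ι c) (ι d) (ι e) (ι f) q)
  where
  l : ∀ a b c d e f q → (a ℚ.+ d) ℚ.+ ((b ℚ.+ e) ℚ.* q ℚ.+ (c ℚ.+ f) ℚ.* (q ℚ.* q))
      ≡ (a ℚ.+ (b ℚ.* q ℚ.+ c ℚ.* (q ℚ.* q))) ℚ.+ (d ℚ.+ (e ℚ.* q ℚ.+ f ℚ.* (q ℚ.* q)))
  l = solve 7 (λ a b c d e f q → (a :+ d) :+ ((b :+ e) :* q :+ (c :+ f) :* (q :* q))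
      := (a :+ (b :* q :+ c :* (q :* q))) :+ (d :+ (e :* q :+ f :* (q :* q)))) refl

eval-⊝ : ∀ x q → eval (⊝ x) q ≡ ℚ.- eval x q
eval-⊝ ⟨ a , b , c ⟩ q =
  trans (cong (λ t → evalℚ t q) (triple-cong (ι-neg a) (ι-neg b) (ι-neg c))) (l (ι a) (ι b) (ι c) q)
  where
  l : ∀ a b c q → (ℚ.- a) ℚ.+ ((ℚ.- b) ℚ.* q ℚ.+ (ℚ.- c) ℚ.* (q ℚ.* q))
      ≡ ℚ.- (a ℚ.+ (b ℚ.* q ℚ.+ c ℚ.* (q ℚ.* q)))
  l = solve 4 (λ a b c q → (:- a) :+ ((:- b) :* q :+ (:- c) :* (q :* q))
      := :- (a :+ (b :* q :+ c :* (q :* q)))) refl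

-- Written exactly as the terms of `IsTribonacciConstant` unfold, with the trailing `* 1` and `- 0`,
-- so that `root` says that `pol` along `γ` is null.
pol : ℚ → ℚ
pol q = q ℚ.* (q ℚ.* (q ℚ.* 1ℚ)) ℚ.+ ℚ.- (q ℚ.* (q ℚ.* 1ℚ)) ℚ.+ ℚ.- q ℚ.+ ℚ.- 1ℚ ℚ.- 0ℚ

-- The quotient of x y by x³ − x² − x − 1, for x and y read as polynomials.
quotient : ℤ[γ] → ℤ[γ] → ℤ[γ]
quotient ⟨ a , b , c ⟩ ⟨ d , e , f ⟩ = ⟨ b ℤ.* f ℤ.+ c ℤ.* e ℤ.+ c ℤ.* f , c ℤ.* f , 0ℤ ⟩

-- Evaluation at a rational approximation respects products only up to a multiple of `pol q`, the
-- part discarded in reducing by the cubic. It becomes multiplicative in the limit, in `embed-⊗`.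
eval-⊗ : ∀ x y q → eval (x ⊗ y) q ℚ.- eval x q ℚ.* eval y q ≡ (ℚ.- eval (quotient x y) q) ℚ.* pol q
eval-⊗ x@(⟨ a , b , c ⟩) y@(⟨ d , e , f ⟩) q =
  subst₂ (λ u v → evalℚ u q ℚ.- eval x q ℚ.* eval y q ≡ (ℚ.- evalℚ v q) ℚ.* pol q)
    (triple-cong
      (sym (+-hom (a ℤ.* d) x³+x⁴ (ι-* a d) ι-x³+x⁴))
      (sym (+-hom (a ℤ.* e ℤ.+ b ℤ.* d) (x³+x⁴ ℤ.+ c ℤ.* f)
        (+-hom (a ℤ.* e) (b ℤ.* d) (ι-* a e) (ι-* b d)) (+-hom x³+x⁴ (c ℤ.* f) ι-x³+x⁴ (ι-* c f))))
      (sym (+-hom (a ℤ.* f ℤ.+ (b ℤ.* e ℤ.+ c ℤ.* d)) (x³+x⁴ ℤ.+ c ℤ.* f)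
        (+-hom (a ℤ.* f) (b ℤ.* e ℤ.+ c ℤ.* d) (ι-* a f) (+-hom (b ℤ.* e) (c ℤ.* d) (ι-* b e) (ι-* c d)))
        (+-hom x³+x⁴ (c ℤ.* f) ι-x³+x⁴ (ι-* c f)))))
    (triple-cong (sym ι-x³+x⁴) (sym (ι-* c f)) (refl {x = 0ℚ}))
    (l (ι a) (ι b) (ι c) (ι d) (ι e) (ι f) q)
  where
  +-hom : ∀ m n {p q} → ι m ≡ p → ι n ≡ q → ι (m ℤ.+ n) ≡ p ℚ.+ q
  +-hom m n eq₁ eq₂ = trans (ι-+ m n) (cong₂ ℚ._+_ eq₁ eq₂)

  x³+x⁴ : ℤ
  x³+x⁴ = b ℤ.* f ℤ.+ c ℤ.* e ℤ.+ c ℤ.* f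

  ι-x³+x⁴ : ι x³+x⁴ ≡ ι b ℚ.* ι f ℚ.+ ι c ℚ.* ι e ℚ.+ ι c ℚ.* ι f
  ι-x³+x⁴ = +-hom (b ℤ.* f ℤ.+ c ℤ.* e) (c ℤ.* f) (+-hom (b ℤ.* f) (c ℤ.* e) (ι-* b f) (ι-* c e)) (ι-* c f)

  module Q = TripleOperations ℚ._+_ ℚ._*_ (ℚ.-_)

  l : ∀ a b c d e f q →
      evalℚ (⟨ a , b , c ⟩ Q.⊗ ⟨ d , e , f ⟩) q ℚ.- evalℚ ⟨ a , b , c ⟩ q ℚ.* evalℚ ⟨ d , e , f ⟩ q
      ≡ (ℚ.- evalℚ ⟨ b ℚ.* f ℚ.+ c ℚ.* e ℚ.+ c ℚ.* f , c ℚ.* f , 0ℚ ⟩ q) ℚ.* pol q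
  l = solve 7 (λ a b c d e f q →
      let t = TripleOperations._⊗_ _:+_ _:*_ (:-_) ⟨ a , b , c ⟩ ⟨ d , e , f ⟩ in
      c₀ t :+ (c₁ t :* q :+ c₂ t :* (q :* q))
        :- (a :+ (b :* q :+ c :* (q :* q))) :* (d :+ (e :* q :+ f :* (q :* q)))
      := (:- ((b :* f :+ c :* e :+ c :* f) :+ ((c :* f) :* q :+ con 0ℚ :* (q :* q))))
        :* (q :* (q :* (q :* con 1ℚ)) :+ :- (q :* (q :* con 1ℚ)) :+ :- q :+ :- con 1ℚ :- con 0ℚ)) refl

-- Reals

≡⇒≃ : ∀ {x y} → (∀ n → seq x n ≡ seq y n) → x ≃ y
≡⇒≃ {x} {y} eq = null-0 (λ n → trans (cong (ℚ._- seq y n) (eq n)) (ℚₚ.+-inverseʳ (seq y n)))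

≃-refl : ∀ {x} → x ≃ x
≃-refl {x} = ≡⇒≃ {x} {x} (λ _ → refl)

≃-sym : ∀ {x y} → x ≃ y → y ≃ x
≃-sym {x} {y} = null-swap {seq x} {seq y}

≃-trans : ∀ {x y z} → x ≃ y → y ≃ z → x ≃ z
≃-trans {x} {y} {z} p q = null-resp (λ n → eq (seq x n) (seq y n) (seq z n)) (null-+ p q)
  where
  eq : ∀ x y z → (x ℚ.- y) ℚ.+ (y ℚ.- z) ≡ x ℚ.- z
  eq = solve 3 (λ x y z → (x :- y) :+ (y :- z) := x :- z) refl

+-cong : ∀ {x x′ y y′} → x ≃ x′ → y ≃ y′ → x + y ≃ x′ + y′
+-cong {x} {x′} {y} {y′} p q = null-resp (λ n → eq (seq x n) (seq x′ n) (seq y n) (seq y′ n)) (null-+ p q)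
  where
  eq : ∀ a b c d → (a ℚ.- b) ℚ.+ (c ℚ.- d) ≡ (a ℚ.+ c) ℚ.- (b ℚ.+ d)
  eq = solve 4 (λ a b c d → (a :- b) :+ (c :- d) := (a :+ c) :- (b :+ d)) refl

*-congˡ : ∀ z {x y} → x ≃ y → z * x ≃ z * y
*-congˡ z {x} {y} p = null-resp (λ n → eq (seq z n) (seq x n) (seq y n)) (null-* (bounded z) p)
  where
  eq : ∀ z x y → z ℚ.* (x ℚ.- y) ≡ z ℚ.* x ℚ.- z ℚ.* y
  eq = solve 3 (λ z x y → z :* (x :- y) := z :* x :- z :* y) refl

*-congʳ : ∀ z {x y} → x ≃ y → x * z ≃ y * z
*-congʳ z {x} {y} p = null-resp (λ n → eq (seq z n) (seq x n) (seq y n)) (null-* (bounded z) p)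
  where
  eq : ∀ z x y → z ℚ.* (x ℚ.- y) ≡ x ℚ.* z ℚ.- y ℚ.* z
  eq = solve 3 (λ z x y → z :* (x :- y) := x :* z :- y :* z) refl

neg-cong : ∀ {x y} → x ≃ y → - x ≃ - y
neg-cong {x} {y} p = null-resp (λ n → eq (seq x n) (seq y n)) (null-swap {seq x} {seq y} p)
  where
  eq : ∀ x y → y ℚ.- x ≡ (ℚ.- x) ℚ.- (ℚ.- y)
  eq = solve 2 (λ x y → y :- x := (:- x) :- (:- y)) refl

<⇒positive : ∀ {x y} → x < y → Positive (λ n → seq y n ℚ.- seq x n)
<⇒positive {x} {y} (ε , 0<ε , h) = ε , 0<ε , eventually-map (λ n h → ≤-by h (eq ε (seq x n) (seq y n))) h
  where
  eq : ∀ e x y → y ℚ.- (e ℚ.+ x) ≡ (y ℚ.- x) ℚ.- e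
  eq = solve 3 (λ e x y → y :- (e :+ x) := (y :- x) :- e) refl

positive⇒< : ∀ {x y} → Positive (λ n → seq y n ℚ.- seq x n) → x < y
positive⇒< {x} {y} (ε , 0<ε , h) = ε , 0<ε , eventually-map (λ n h → ≤-by h (eq ε (seq x n) (seq y n))) h
  where
  eq : ∀ e x y → (y ℚ.- x) ℚ.- e ≡ y ℚ.- (e ℚ.+ x)
  eq = solve 3 (λ e x y → (y :- x) :- e := y :- (e :+ x)) refl

<⇒≤ : ∀ {x y} → x < y → x ≤ y
<⇒≤ {x} {y} (ε , 0<ε , h) δ 0<δ =
  eventually-map (λ n h → ≤-by (ℚₚ.+-mono-≤ (ℚₚ.+-mono-≤ (ℚₚ.<⇒≤ 0<ε) h) (ℚₚ.<⇒≤ 0<δ)) (eq ε δ (seq x n) (seq y n))) h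
  where
  eq : ∀ e d x y → e ℚ.+ y ℚ.+ d ℚ.- (0ℚ ℚ.+ (e ℚ.+ x) ℚ.+ 0ℚ) ≡ y ℚ.+ d ℚ.- x
  eq = solve 4 (λ e d x y → e :+ y :+ d :- (con 0ℚ :+ (e :+ x) :+ con 0ℚ) := y :+ d :- x) refl

≤⇒≯ : ∀ {x y} → x ≤ y → y < x → ⊥
≤⇒≯ {x} {y} x≤y (ε , 0<ε , h) = absurd (eventually-zip {R = λ _ → ε ℚ.≤ ½ ℚ.* ε}
  (λ n p q → ≤-by (ℚₚ.+-mono-≤ p q) (eq ε (½ ℚ.* ε) (seq x n) (seq y n))) h (x≤y (½ ℚ.* ε) (½ε>0 0<ε)))
  where
  eq : ∀ e h x y → x ℚ.+ (y ℚ.+ h) ℚ.- (e ℚ.+ y ℚ.+ x) ≡ h ℚ.- e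
  eq = solve 4 (λ e h x y → x :+ (y :+ h) :- (e :+ y :+ x) := h :- e) refl
  absurd : Eventually (λ _ → ε ℚ.≤ ½ ℚ.* ε) → ⊥
  absurd (N , h) = ℚₚ.<-irrefl refl (ℚₚ.<-≤-trans
    (subst₂ ℚ._<_ (ℚₚ.+-identityʳ (½ ℚ.* ε)) (½ε+½ε≡ε ε) (ℚₚ.+-monoʳ-< (½ ℚ.* ε) (½ε>0 0<ε)))
    (h N ℕₚ.≤-refl))

<-shift : ∀ {x y x′ y′} → (y - x) ≃ (y′ - x′) → x < y → x′ < y′
<-shift {x} {y} {x′} {y′} eq p = positive⇒< {x′} {y′} (positive-resp-null eq (<⇒positive {x} {y} p))

≤-shift : ∀ {x y x′ y′} → (y - x) ≃ (y′ - x′) → x ≤ y → x′ ≤ y′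
≤-shift {x} {y} {x′} {y′} null p ε 0<ε = eventually-zip
  (λ n h k → ≤-by (ℚₚ.+-mono-≤ h (ℚₚ.≤-trans (p≤∣p∣ (seq (y - x) n ℚ.- seq (y′ - x′) n)) k))
    (eq (seq x n) (seq y n) (seq x′ n) (seq y′ n) ε))
  (p (½ ℚ.* ε) (½ε>0 0<ε)) (null (½ ℚ.* ε) (½ε>0 0<ε))
  where
  eq : ∀ x y x′ y′ e → y ℚ.+ ½ ℚ.* e ℚ.+ ½ ℚ.* e ℚ.- (x ℚ.+ ((y ℚ.- x) ℚ.- (y′ ℚ.- x′))) ≡ y′ ℚ.+ e ℚ.- x′
  eq = solve 5 (λ x y x′ y′ e → y :+ con ½ :* e :+ con ½ :* e :- (x :+ ((y :- x) :- (y′ :- x′))) := y′ :+ e :- x′) refl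

*-inv : ∀ x (0<x : 0ℝ < x) → x * inv x 0<x ≃ 1ℝ
*-inv x (ε , 0<ε , N , h) δ 0<δ = N , λ n n≥ → subst (λ p → ∣ p ℚ.- 1ℚ ∣ ℚ.≤ δ)
  (sym (inverse n (subst (ℚ._≤ seq x n) (ℚₚ.+-identityʳ ε) (h n n≥)))) (ℚₚ.<⇒≤ 0<δ)
  where
  inverse : ∀ n → ε ℚ.≤ seq x n → seq (x * inv x (ε , 0<ε , N , h)) n ≡ 1ℚ
  inverse n ε≤x = trans (cong (ℚ._* seq (inv x (ε , 0<ε , N , h)) n) (sym (ℚₚ.p≥q⇒p⊔q≡p ε≤x)))
    (ℚₚ.*-inverseʳ (seq x n ℚ.⊔ ε) {{_}})

null-*-cancelˡ : ∀ {s t} → Positive s → Null (λ n → s n ℚ.* t n) → Null t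
null-*-cancelˡ {s} {t} (δ , 0<δ , h) null ε 0<ε = eventually-zip
  (λ n δ≤s st≤ → ℚₚ.*-cancelˡ-≤-pos δ {{ℚ.positive 0<δ}}
    (ℚₚ.≤-trans (ℚₚ.*-monoʳ-≤-nonNeg ∣ t n ∣ {{ℚ.nonNegative (ℚₚ.0≤∣p∣ (t n))}}
                  (ℚₚ.≤-trans δ≤s (p≤∣p∣ (s n))))
      (subst (ℚ._≤ δ ℚ.* ε) (ℚₚ.∣p*q∣≡∣p∣*∣q∣ (s n) (t n)) st≤)))
  h (null (δ ℚ.* ε) (*-pos 0<δ 0<ε))

archimedean : ∀ p → ∃ λ m → p ℚ.≤ ι (+ m)
archimedean p@record{} = ℤ.∣ ℚ.numerator p ∣ , ℚₚ.toℚᵘ-cancel-≤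
  (ℚᵘₚ.≤-respʳ-≃ (ℚᵘₚ.≃-sym (toℚᵘ-ι (+ ℤ.∣ ℚ.numerator p ∣))) (ℚᵘ.*≤* (bound (ℚ.numerator p))))
  where
  bound : ∀ n → n ℤ.* 1ℤ ℤ.≤ + ℤ.∣ n ∣ ℤ.* + suc (ℚ.denominator-1 p)
  bound n = ℤₚ.≤-trans (ℤₚ.≤-reflexive (ℤₚ.*-identityʳ n)) (ℤₚ.≤-trans (i≤∣i∣ n)
    (ℤₚ.≤-trans (ℤ.+≤+ (ℕₚ.m≤m*n ℤ.∣ n ∣ (suc (ℚ.denominator-1 p)))) (ℤₚ.≤-reflexive (ℤₚ.pos-* ℤ.∣ n ∣ _))))
    where
    i≤∣i∣ : ∀ i → i ℤ.≤ + ℤ.∣ i ∣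
    i≤∣i∣ (+ n)    = ℤₚ.≤-refl
    i≤∣i∣ -[1+ n ] = ℤ.-≤+

-- The automaton

-- Positive elements have γⁿ t with positive coordinates for large n, because
-- γ is the dominant eigenvalue of multiplication by γ.
positiveᵇ : ℕ → ℤ[γ] → Bool
positiveᵇ _       ⟨ +[1+ _ ] , + _ , + _ ⟩ = true
positiveᵇ zero    _                        = false
positiveᵇ (suc n) t                        = positiveᵇ n (γ̂ ⊗ t)

-- `γ² − γ − 1`, from `γ (γ² − γ − 1) = 1`.
γ̂⁻¹ : ℤ[γ]
γ̂⁻¹ = ⟨ -[1+ 0 ] , -[1+ 0 ] , 1ℤ ⟩

unshift : ℤ[γ] → ℤ[γ]
unshift t = ⊝ (γ̂⁻¹ ⊗ t)

shift-unshift : ∀ t → shift (unshift t) 0ℤ ≡ t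
shift-unshift = l
  where
  l : ∀ t → ⊝ (γ̂ ⊗ (⊝ (γ̂⁻¹ ⊗ t))) ⊕ ⊝ 0̂ ≡ t
  l = solve-∀ ℤ[γ]-ring

unshift-shift : ∀ t → unshift (shift t 0ℤ) ≡ t
unshift-shift = l
  where
  l : ∀ t → ⊝ (γ̂⁻¹ ⊗ (⊝ (γ̂ ⊗ t) ⊕ ⊝ 0̂)) ≡ t
  l = solve-∀ ℤ[γ]-ring

_≟_ : DecidableEquality ℤ[γ]
⟨ a , b , c ⟩ ≟ ⟨ d , e , f ⟩ = map′ (λ (p , q , r) → triple-cong p q r)
  (λ { refl → refl , refl , refl }) ((a ℤₚ.≟ d) ×-dec (b ℤₚ.≟ e) ×-dec (c ℤₚ.≟ f))

open DecMembership _≟_ using (_∈?_)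

⟦_⟧ : Bool → ℤ
⟦ false ⟧ = 0ℤ
⟦ true  ⟧ = 1ℤ

-- The differences t − x − y that occur while t is expanded alongside x and y.
states : List ℤ[γ]
states =
  ⟨ + 0 , + 0 , + 0 ⟩ ∷ ⟨ -[1+ 0 ] , -[1+ 0 ] , + 1 ⟩ ∷ ⟨ -[1+ 0 ] , + 0 , + 0 ⟩ ∷ ⟨ -[1+ 0 ] , + 1 , + 0 ⟩ ∷
  ⟨ + 0 , -[1+ 0 ] , + 1 ⟩ ∷ ⟨ + 1 , -[1+ 0 ] , + 0 ⟩ ∷ ⟨ + 1 , + 0 , + 0 ⟩ ∷ ⟨ + 1 , + 1 , -[1+ 0 ] ⟩ ∷
  ⟨ -[1+ 1 ] , -[1+ 1 ] , + 2 ⟩ ∷ ⟨ -[1+ 1 ] , -[1+ 0 ] , + 1 ⟩ ∷ ⟨ -[1+ 1 ] , + 0 , + 1 ⟩ ∷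
  ⟨ -[1+ 1 ] , + 1 , + 0 ⟩ ∷ ⟨ -[1+ 0 ] , -[1+ 1 ] , + 1 ⟩ ∷ ⟨ -[1+ 0 ] , + 2 , -[1+ 0 ] ⟩ ∷
  ⟨ + 0 , -[1+ 1 ] , + 1 ⟩ ∷ ⟨ + 0 , + 2 , -[1+ 0 ] ⟩ ∷ ⟨ + 1 , -[1+ 1 ] , + 1 ⟩ ∷ ⟨ + 1 , + 2 , -[1+ 0 ] ⟩ ∷
  ⟨ + 2 , -[1+ 0 ] , + 0 ⟩ ∷ ⟨ + 2 , + 1 , -[1+ 0 ] ⟩ ∷ ⟨ -[1+ 2 ] , + 0 , + 1 ⟩ ∷
  ⟨ -[1+ 1 ] , -[1+ 2 ] , + 2 ⟩ ∷ ⟨ -[1+ 0 ] , -[1+ 2 ] , + 2 ⟩ ∷ ⟨ + 0 , -[1+ 2 ] , + 2 ⟩ ∷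
  ⟨ + 1 , -[1+ 2 ] , + 1 ⟩ ∷ ⟨ + 2 , -[1+ 2 ] , + 1 ⟩ ∷ ⟨ + 3 , -[1+ 1 ] , + 0 ⟩ ∷ ⟨ + 3 , -[1+ 0 ] , + 0 ⟩ ∷
  ⟨ + 3 , + 0 , -[1+ 0 ] ⟩ ∷ ⟨ + 3 , + 1 , -[1+ 0 ] ⟩ ∷ []

stateDigits : List ℤ
stateDigits = + 1 ∷ + 0 ∷ -[1+ 0 ] ∷ -[1+ 1 ] ∷ []

digit-difference : ∀ p q r → ⟦ p ⟧ ℤ.- ⟦ q ⟧ ℤ.- ⟦ r ⟧ ∈ stateDigits
digit-difference false false false = there (here refl)
digit-difference false false true  = there (there (here refl))
digit-difference false true  false = there (there (here refl))
digit-difference false true  true  = there (there (there (here refl)))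
digit-difference true  false false = here refl
digit-difference true  false true  = there (here refl)
digit-difference true  true  false = there (here refl)
digit-difference true  true  true  = there (there (here refl))

-- (γ + 1) (1 − ℓ − s) and (γ + 1) (s + ℓ + 2)
above below : ℤ[γ] → ℤ[γ]
above s = 1̂ ⊕ γ̂ ⊕ γ̂ ⊕ ⊝ ((γ̂ ⊕ 1̂) ⊗ s)
below s = 1̂ ⊕ 1̂ ⊕ γ̂ ⊕ (γ̂ ⊕ 1̂) ⊗ s

-- Any value is sound; it only has to be large enough for the closed tests in this proof to succeed.
fuel : ℕ
fuel = 20

Negativeᵇ : ℤ[γ] → Set
Negativeᵇ t = T (positiveᵇ fuel (⊝ t))

insideᵇ : ℤ[γ] → Bool
insideᵇ t = positiveᵇ fuel (lo t) ∧ positiveᵇ fuel (hi t)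

reachᵇ : ℕ → ℤ[γ] → Bool
-- Comparison with 0 only at depth 0 loses nothing: 0 is inside and digit 0 fixes it, so an orbit
-- arriving early is padded with zeros.
reachᵇ zero    t = ⌊ t ≟ 0̂ ⌋
reachᵇ (suc n) t = insideᵇ t ∧ (reachᵇ n (shift t 0ℤ) ∨ reachᵇ n (shift t 1ℤ))

-- The alternatives discard points that cannot occur: a successor outside the strip of differences,
-- or a state that is not in the interval of `T`.
Closed Terminates : ℤ[γ] → Set
Closed s = All (λ e → shift s e ∈ states ⊎ (Negativeᵇ (above (shift s e)) ⊎ Negativeᵇ (below (shift s e)))) stateDigits
Terminates s = T (reachᵇ 6 s) ⊎ (Negativeᵇ (lo s) ⊎ Negativeᵇ (hi s))

-- Both tables are decided by evaluation; `abstract` keeps that evaluation from being unfolded where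
-- they are used.
abstract
  states-closed : All Closed states
  states-closed = toWitness {a? = All.all? (λ s → All.all? (λ e →
    (shift s e ∈? states) ⊎-dec (T? _ ⊎-dec T? _)) stateDigits) states} _

  states-terminate : All (λ s → Terminates s × Terminates (⊝ s)) states
  states-terminate = toWitness {a? = All.all? (λ s →
    (T? _ ⊎-dec (T? _ ⊎-dec T? _)) ×-dec (T? _ ⊎-dec (T? _ ⊎-dec T? _))) states} _

-- Identities in ℤ[γ] behind the inequalities

γ-lo-shift : ∀ u → γ̂ ⊗ lo u ≡ hi (shift u 0ℤ) ⊕ (γ̂ ⊗ γ̂ ⊕ ⊝ 1̂)
γ-lo-shift = l
  where
  l : ∀ u → γ̂ ⊗ ((γ̂ ⊕ 1̂) ⊗ u ⊕ γ̂) ≡ (1̂ ⊕ ⊝ ((γ̂ ⊕ 1̂) ⊗ (⊝ (γ̂ ⊗ u) ⊕ ⊝ 0̂)))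
          ⊕ (γ̂ ⊗ γ̂ ⊕ ⊝ 1̂)
  l = solve-∀ ℤ[γ]-ring

-- Multiplication by `−γ` carries the endpoint `ℓ + 1` to `ℓ`, so no slack term appears, unlike in
-- `γ-lo-shift`.
γ-hi-shift : ∀ u → γ̂ ⊗ hi u ≡ lo (shift u 0ℤ)
γ-hi-shift = l
  where
  l : ∀ u → γ̂ ⊗ (1̂ ⊕ ⊝ ((γ̂ ⊕ 1̂) ⊗ u)) ≡ (γ̂ ⊕ 1̂) ⊗ (⊝ (γ̂ ⊗ u) ⊕ ⊝ 0̂) ⊕ γ̂
  l = solve-∀ ℤ[γ]-ring

hi-shift-1 : ∀ t → γ̂ ⊗ lo t ⊕ (1̂ ⊕ 1̂ ⊕ γ̂ ⊕ ⊝ (γ̂ ⊗ γ̂)) ≡ hi (shift t 1ℤ)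
hi-shift-1 = l
  where
  l : ∀ t → γ̂ ⊗ ((γ̂ ⊕ 1̂) ⊗ t ⊕ γ̂) ⊕ (1̂ ⊕ 1̂ ⊕ γ̂ ⊕ ⊝ (γ̂ ⊗ γ̂)) ≡ 1̂ ⊕ ⊝ ((γ̂ ⊕ 1̂) ⊗ (⊝ (γ̂ ⊗ t) ⊕ ⊝ 1̂))
  l = solve-∀ ℤ[γ]-ring

hi-shift-0 : ∀ t → ⊝ lo (shift t 1ℤ) ≡ hi (shift t 0ℤ)
hi-shift-0 = l
  where
  l : ∀ t → ⊝ ((γ̂ ⊕ 1̂) ⊗ (⊝ (γ̂ ⊗ t) ⊕ ⊝ 1̂) ⊕ γ̂) ≡ 1̂ ⊕ ⊝ ((γ̂ ⊕ 1̂) ⊗ (⊝ (γ̂ ⊗ t) ⊕ ⊝ 0̂))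
  l = solve-∀ ℤ[γ]-ring

above-difference : ∀ x y z → hi x ⊕ lo y ⊕ lo z ≡ above (x ⊕ ⊝ y ⊕ ⊝ z)
above-difference = l
  where
  l : ∀ x y z → (1̂ ⊕ ⊝ ((γ̂ ⊕ 1̂) ⊗ x)) ⊕ ((γ̂ ⊕ 1̂) ⊗ y ⊕ γ̂) ⊕ ((γ̂ ⊕ 1̂) ⊗ z ⊕ γ̂)
      ≡ 1̂ ⊕ γ̂ ⊕ γ̂ ⊕ ⊝ ((γ̂ ⊕ 1̂) ⊗ (x ⊕ ⊝ y ⊕ ⊝ z))
  l = solve-∀ ℤ[γ]-ring

below-difference : ∀ x y z → lo x ⊕ hi y ⊕ hi z ≡ below (x ⊕ ⊝ y ⊕ ⊝ z)
below-difference = l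
  where
  l : ∀ x y z → ((γ̂ ⊕ 1̂) ⊗ x ⊕ γ̂) ⊕ (1̂ ⊕ ⊝ ((γ̂ ⊕ 1̂) ⊗ y)) ⊕ (1̂ ⊕ ⊝ ((γ̂ ⊕ 1̂) ⊗ z))
      ≡ 1̂ ⊕ 1̂ ⊕ γ̂ ⊕ (γ̂ ⊕ 1̂) ⊗ (x ⊕ ⊝ y ⊕ ⊝ z)
  l = solve-∀ ℤ[γ]-ring

shift-difference : ∀ x y z p q r →
  shift (x ⊕ ⊝ y ⊕ ⊝ z) (p ℤ.- q ℤ.- r) ≡ shift x p ⊕ ⊝ shift y q ⊕ ⊝ shift z r
shift-difference x y z p q r = l x y z (κ p) (κ q) (κ r)
  where
  l : ∀ x y z p q r → ⊝ (γ̂ ⊗ (x ⊕ ⊝ y ⊕ ⊝ z)) ⊕ ⊝ (p ⊕ ⊝ q ⊕ ⊝ r)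
      ≡ (⊝ (γ̂ ⊗ x) ⊕ ⊝ p) ⊕ ⊝ (⊝ (γ̂ ⊗ y) ⊕ ⊝ q) ⊕ ⊝ (⊝ (γ̂ ⊗ z) ⊕ ⊝ r)
  l = solve-∀ ℤ[γ]-ring

-- Signs of elements of ℤ[γ] evaluated at `γ`

module TribonacciBase (γ : ℝ) (root : IsTribonacciConstant γ) where

  embed : ℤ[γ] → ℝ
  embed ⟨ a , b , c ⟩ = fromℤ a + (fromℤ b * γ + fromℤ c * (γ * γ))

  embed-⊗ : ∀ x y → Null (λ n → seq (embed (x ⊗ y)) n ℚ.- seq (embed x) n ℚ.* seq (embed y) n)
  embed-⊗ x y = null-resp (λ n → sym (eval-⊗ x y (seq γ n)))
    (null-* (bounded (- embed (quotient x y))) root)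

  -- A record without eta, so that types are compared by the triple `t` and not by unfolded
  -- sequences of rationals.
  record Pos (t : ℤ[γ]) : Set where
    constructor pos
    no-eta-equality
    pattern
    field positive : Positive (seq (embed t))

  open Pos public

  pos-⊕ : ∀ x y → Pos x → Pos y → Pos (x ⊕ y)
  pos-⊕ x y (pos p) (pos q) = pos (positive-resp (λ n → sym (eval-⊕ x y (seq γ n))) (positive-+ p q))

  pos-⊗ : ∀ x y → Pos x → Pos y → Pos (x ⊗ y)
  pos-⊗ x y (pos p) (pos q) = pos (positive-resp-null
    (null-swap {seq (embed (x ⊗ y))} {seq (embed x * embed y)} (embed-⊗ x y)) (positive-* p q))

  pos-⊗-cancelˡ : ∀ x y → Pos x → Pos (x ⊗ y) → Pos y
  pos-⊗-cancelˡ x y (pos p) (pos q) =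
    pos (positive-*-cancelˡ (bounded (embed x)) p (positive-resp-null (embed-⊗ x y) q))

  pos-asym : ∀ x → Pos x → Pos (⊝ x) → ⊥
  pos-asym x (pos p) (pos q) = positive-asym p (positive-resp (λ n → eval-⊝ x (seq γ n)) q)

  γ-positive : Positive (seq γ)
  γ-positive with tribonacci>1 γ root
  ... | ε , 0<ε , h = ε , 0<ε , eventually-map
    (λ n → ℚₚ.≤-trans (subst (ℚ._≤ ε ℚ.+ 1ℚ) (ℚₚ.+-identityʳ ε) (ℚₚ.+-monoʳ-≤ ε (ℚₚ.nonNegative⁻¹ 1ℚ)))) h

  pos-γ̂ : Pos γ̂
  pos-γ̂ = pos (positive-resp (λ n → l (seq γ n)) γ-positive)
    where
    l : ∀ q → q ≡ 0ℚ ℚ.+ (1ℚ ℚ.* q ℚ.+ 0ℚ ℚ.* (q ℚ.* q))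
    l = solve 1 (λ q → q := con 0ℚ :+ (con 1ℚ :* q :+ con 0ℚ :* (q :* q))) refl

  -- In the accepting case the value is at least 1, since the constant coordinate is a positive
  -- integer and `γ > 0`. Each unit of fuel is undone by cancelling the positive factor `γ`.
  positiveᵇ-sound : ∀ n t → T (positiveᵇ n t) → Pos t
  positiveᵇ-sound n ⟨ +[1+ a ] , + b , + c ⟩ _ =
    let ε , 0<ε , h = γ-positive in
    pos (1ℚ , ℚₚ.positive⁻¹ 1ℚ , eventually-map (λ k ε≤γ →
    let 0≤γ = ℚₚ.≤-trans (ℚₚ.<⇒≤ 0<ε) ε≤γ in
    ℚₚ.+-mono-≤ {1ℚ} {ι +[1+ a ]} {0ℚ} (1≤ι a)
      (ℚₚ.+-mono-≤ {0ℚ} {ι (+ b) ℚ.* seq γ k} {0ℚ}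
        (0≤* (0≤ι b) 0≤γ) (0≤* (0≤ι c) (0≤* 0≤γ 0≤γ)))) h)
    where
    0≤* : ∀ {p q} → 0ℚ ℚ.≤ p → 0ℚ ℚ.≤ q → 0ℚ ℚ.≤ p ℚ.* q
    0≤* 0≤p 0≤q = *-mono {0ℚ} {_} {0ℚ} 0≤p ℚₚ.≤-refl 0≤p 0≤q
  positiveᵇ-sound (suc n) t@(⟨ ℤ.+0 , _ , _ ⟩) h = pos-⊗-cancelˡ γ̂ t pos-γ̂ (positiveᵇ-sound n (γ̂ ⊗ t) h)
  positiveᵇ-sound (suc n) t@(⟨ -[1+ _ ] , _ , _ ⟩) h = pos-⊗-cancelˡ γ̂ t pos-γ̂ (positiveᵇ-sound n (γ̂ ⊗ t) h)
  positiveᵇ-sound (suc n) t@(⟨ +[1+ _ ] , -[1+ _ ] , _ ⟩) h = pos-⊗-cancelˡ γ̂ t pos-γ̂ (positiveᵇ-sound n (γ̂ ⊗ t) h)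
  positiveᵇ-sound (suc n) t@(⟨ +[1+ _ ] , + _ , -[1+ _ ] ⟩) h = pos-⊗-cancelˡ γ̂ t pos-γ̂ (positiveᵇ-sound n (γ̂ ⊗ t) h)

  -- The product with the adjugate is a nonzero integer and the adjugate is bounded, so `x` is
  -- bounded away from 0; a Cauchy sequence of that kind has a sign.
  norm≢0⇒sign : ∀ x → norm x ≢ 0ℤ → Pos x ⊎ Pos (⊝ x)
  norm≢0⇒sign x norm≢0 = Sum.map pos (λ p → pos (positive-resp (λ n → sym (eval-⊝ x (seq γ n))) p))
    (cauchy-sign {seq (embed x)} (cauchy (embed x))
      (apart-of-product {seq (embed x)} {seq (embed (adjugate x))} {ι (norm x)}
        (bounded (embed (adjugate x))) null (1≤∣ι∣ norm≢0)))
    where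
    null : Null (λ n → ι (norm x) ℚ.- seq (embed (adjugate x)) n ℚ.* seq (embed x) n)
    null = null-resp
      (λ n → cong (ℚ._- seq (embed (adjugate x)) n ℚ.* seq (embed x) n)
        (trans (cong (λ y → eval y (seq γ n)) (adjugate-⊗ x)) (eval-κ (norm x) (seq γ n))))
      (embed-⊗ (adjugate x) x)

  ℓ-dichotomy : ∀ t → Pos (lo t) ⊎ Pos (⊝ lo t)
  ℓ-dichotomy t = norm≢0⇒sign (lo t) (λ eq → odd≢0 (half-norm t) (trans (sym (norm-odd t)) eq))

  pos-κ : ∀ n → Pos (κ n) → ∃ λ m → n ≡ +[1+ m ]
  pos-κ +[1+ m ] p = m , refl
  pos-κ ℤ.+0 p = ⊥-elim (pos-asym (κ 0ℤ) p p)
  pos-κ -[1+ m ] p = ⊥-elim (pos-asym (κ -[1+ m ]) p (positiveᵇ-sound 0 (κ +[1+ m ]) _))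

  -- Orbits that reach 0

  -- Strict at both ends although `T` lives on `[ℓ, ℓ+1)`: no element of ℤ[γ] equals `ℓ`.
  Inside : ℤ[γ] → Set
  Inside t = Pos (lo t) × Pos (hi t)

  -- The index is a length, not the least one, as `reach-unshift` may prefix zeros. Digits are
  -- Booleans because `⌊γ⌋ = 1`.
  data Reach : ℕ → ℤ[γ] → Set where
    done : Reach 0 0̂
    step : ∀ {n t} b → Inside t → Reach n (shift t ⟦ b ⟧) → Reach (suc n) t

  positive! : ∀ t {_ : T (positiveᵇ fuel t)} → Pos t
  positive! t {p} = positiveᵇ-sound fuel t p

  insideᵇ-sound : ∀ t → T (insideᵇ t) → Inside t
  insideᵇ-sound t h =
    let p , q = Equivalence.to (T-∧ {positiveᵇ fuel (lo t)} {positiveᵇ fuel (hi t)}) h in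
    positiveᵇ-sound fuel (lo t) p , positiveᵇ-sound fuel (hi t) q

  reachᵇ-sound : ∀ n t → T (reachᵇ n t) → Reach n t
  reachᵇ-sound zero    t h = subst (Reach 0) (sym (toWitness {a? = t ≟ 0̂} h)) done
  reachᵇ-sound (suc n) t h =
    let p , q = Equivalence.to (T-∧ {insideᵇ t} {reachᵇ n (shift t 0ℤ) ∨ reachᵇ n (shift t 1ℤ)}) h in
    Sum.[ (λ r → step false (insideᵇ-sound t p) (reachᵇ-sound n (shift t 0ℤ) r))
        , (λ r → step true  (insideᵇ-sound t p) (reachᵇ-sound n (shift t 1ℤ) r))
        ] (Equivalence.to (T-∨ {reachᵇ n (shift t 0ℤ)} {reachᵇ n (shift t 1ℤ)}) q)

  negativeᵇ-sound : ∀ t → Negativeᵇ t → Pos t → ⊥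
  negativeᵇ-sound t h p = pos-asym t p (positiveᵇ-sound fuel (⊝ t) h)

  terminates-sound : ∀ t → Terminates t → Inside t → Reach 6 t
  terminates-sound t (inj₁ h)        _       = reachᵇ-sound 6 t h
  terminates-sound t (inj₂ (inj₁ h)) (p , _) = ⊥-elim (negativeᵇ-sound (lo t) h p)
  terminates-sound t (inj₂ (inj₂ h)) (_ , p) = ⊥-elim (negativeᵇ-sound (hi t) h p)

  reach⇒inside : ∀ {n t} → Reach n t → Inside t
  reach⇒inside done         = insideᵇ-sound 0̂ _
  reach⇒inside (step _ i _) = i

  -- Division by `−γ` maps the interval into itself: it returns `ℓ` to `ℓ + 1`, and the other end
  -- has the slack `γ² − 1 > 0`.
  inside-shift⁻ : ∀ t → Inside (shift t 0ℤ) → Inside t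
  inside-shift⁻ t (p , q) =
      pos-⊗-cancelˡ γ̂ (lo t) pos-γ̂ (subst Pos (sym (γ-lo-shift t))
        (pos-⊕ (hi (shift t 0ℤ)) (γ̂ ⊗ γ̂ ⊕ ⊝ 1̂) q (positive! (γ̂ ⊗ γ̂ ⊕ ⊝ 1̂))))
    , pos-⊗-cancelˡ γ̂ (hi t) pos-γ̂ (subst Pos (sym (γ-hi-shift t)) p)

  inside-unshift : ∀ t → Inside t → Inside (unshift t)
  inside-unshift t i = inside-shift⁻ (unshift t) (subst Inside (sym (shift-unshift t)) i)

  -- `(γ + 1)` times the distance from `−γℓ − 1` up to `ℓ + 1`. Its positivity, `γ² < γ + 2`, is why
  -- no digit beyond 1 is required.
  gap : ℤ[γ]
  gap = 1̂ ⊕ 1̂ ⊕ γ̂ ⊕ ⊝ (γ̂ ⊗ γ̂)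

  inside-shift-1 : ∀ t → Pos (lo t) → Pos (lo (shift t 1ℤ)) → Inside (shift t 1ℤ)
  inside-shift-1 t p r = r , subst Pos (hi-shift-1 t)
    (pos-⊕ (γ̂ ⊗ lo t) gap (pos-⊗ γ̂ (lo t) pos-γ̂ p) (positive! gap))

  inside-shift-0 : ∀ t → Pos (hi t) → Pos (⊝ lo (shift t 1ℤ)) → Inside (shift t 0ℤ)
  inside-shift-0 t q r = subst Pos (γ-hi-shift t) (pos-⊗ γ̂ (hi t) pos-γ̂ q) , subst Pos (hi-shift-0 t) r

  -- The floor is computable on ℤ[γ]: the digit is 1 or 0 according to the side of `ℓ` on which
  -- `−γ t − 1` falls.
  next-digit : ∀ t → Inside t → ∃ λ b → Inside (shift t ⟦ b ⟧)
  next-digit t (p , q) = Sum.[ (λ r → true , inside-shift-1 t p r) , (λ r → false , inside-shift-0 t q r) ]′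
    (ℓ-dichotomy (shift t 1ℤ))

  -- The two digits exclude each other, since `hi (shift t 0ℤ)` is the negative of
  -- `lo (shift t 1ℤ)`. This lets a leading zero be removed.
  reach-shift : ∀ {n} t → Inside (shift t 0ℤ) → Reach (suc n) t → Reach n (shift t 0ℤ)
  reach-shift t i       (step false _ r) = r
  reach-shift t (_ , q) (step true  _ r) = ⊥-elim (pos-asym (lo (shift t 1ℤ)) (proj₁ (reach⇒inside r))
    (subst Pos (sym (hi-shift-0 t)) q))

  reach-unshift : ∀ {n} t → Reach n t → Reach (suc n) (unshift t)
  reach-unshift {n} t r = step false (inside-unshift t (reach⇒inside r)) (subst (Reach n) (sym (shift-unshift t)) r)

  state-step : ∀ x y z p q r → Inside (shift x ⟦ p ⟧) → Inside (shift y ⟦ q ⟧) → Inside (shift z ⟦ r ⟧) →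
    x ⊕ ⊝ y ⊕ ⊝ z ∈ states → shift x ⟦ p ⟧ ⊕ ⊝ shift y ⟦ q ⟧ ⊕ ⊝ shift z ⟦ r ⟧ ∈ states
  state-step x y z p q r (lx , hx) (ly , hy) (lz , hz) s∈ =
    subst (_∈ states) eq (resolve (All.lookup (All.lookup states-closed s∈) (digit-difference p q r)))
    where
    s′ = shift (x ⊕ ⊝ y ⊕ ⊝ z) (⟦ p ⟧ ℤ.- ⟦ q ⟧ ℤ.- ⟦ r ⟧)
    x′ = shift x ⟦ p ⟧
    y′ = shift y ⟦ q ⟧
    z′ = shift z ⟦ r ⟧
    eq : s′ ≡ x′ ⊕ ⊝ y′ ⊕ ⊝ z′
    eq = shift-difference x y z ⟦ p ⟧ ⟦ q ⟧ ⟦ r ⟧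
    resolve : s′ ∈ states ⊎ (Negativeᵇ (above s′) ⊎ Negativeᵇ (below s′)) → s′ ∈ states
    resolve (inj₁ h)        = h
    resolve (inj₂ (inj₁ h)) = ⊥-elim (negativeᵇ-sound (above s′) h
      (subst Pos (trans (above-difference x′ y′ z′) (cong above (sym eq)))
        (pos-⊕ (hi x′ ⊕ lo y′) (lo z′) (pos-⊕ (hi x′) (lo y′) hx ly) lz)))
    resolve (inj₂ (inj₂ h)) = ⊥-elim (negativeᵇ-sound (below s′) h
      (subst Pos (trans (below-difference x′ y′ z′) (cong below (sym eq)))
        (pos-⊕ (lo x′ ⊕ hi y′) (hi z′) (pos-⊕ (lo x′) (hi y′) lx hy) hz)))

  reach-sum : ∀ {n x y} t → Reach n x → Reach n y → Inside t → t ⊕ ⊝ x ⊕ ⊝ y ∈ states → Reach (n ℕ.+ 6) t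
  reach-sum t done done i s∈ =
    terminates-sound t (proj₁ (All.lookup states-terminate (subst (_∈ states) (eq t) s∈))) i
    where
    eq : ∀ t → t ⊕ ⊝ 0̂ ⊕ ⊝ 0̂ ≡ t
    eq = solve-∀ ℤ[γ]-ring
  reach-sum {x = x} {y} t (step p _ rx) (step q _ ry) i s∈ =
    let b , i′ = next-digit t i in
    step b i (reach-sum (shift t ⟦ b ⟧) rx ry i′
    (state-step t x y b p q i′ (reach⇒inside rx) (reach⇒inside ry) s∈))

  -- t = x − y is x = t + y, so the same automaton runs with x as the sum.
  reach-difference : ∀ {n x y} t → Reach n x → Reach n y → Inside t → x ⊕ ⊝ t ⊕ ⊝ y ∈ states → Reach (n ℕ.+ 6) t
  reach-difference t done done i s∈ =
    terminates-sound t (subst Terminates (eq t) (proj₂ (All.lookup states-terminate s∈))) i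
    where
    eq : ∀ t → ⊝ (0̂ ⊕ ⊝ t ⊕ ⊝ 0̂) ≡ t
    eq = solve-∀ ℤ[γ]-ring
  reach-difference {x = x} {y} t (step p _ rx) (step q _ ry) i s∈ =
    let b , i′ = next-digit t i in
    step b i (reach-difference (shift t ⟦ b ⟧) rx ry i′
    (state-step x t y p b q (reach⇒inside rx) i′ (reach⇒inside ry) s∈))

  -- From real orbits to ℤ[γ]

  open NegativeBase γ (tribonacci>1 γ root)

  γ⁻¹ : ℝ
  γ⁻¹ = inv γ (1<⇒0< {γ} (tribonacci>1 γ root))

  [γ+1]⁻¹ : ℝ
  [γ+1]⁻¹ = inv (γ + 1ℝ) (1<⇒0<+1 {γ} (tribonacci>1 γ root))

  embed-⊕ : ∀ x y → embed (x ⊕ y) ≃ embed x + embed y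
  embed-⊕ x y = ≡⇒≃ {embed (x ⊕ y)} {embed x + embed y} (λ n → eval-⊕ x y (seq γ n))

  embed-⊝ : ∀ x → embed (⊝ x) ≃ - embed x
  embed-⊝ x = ≡⇒≃ {embed (⊝ x)} { - embed x} (λ n → eval-⊝ x (seq γ n))

  γ+1-positive : Positive (seq (γ + 1ℝ))
  γ+1-positive = positive-+ γ-positive (1ℚ , ℚₚ.positive⁻¹ 1ℚ , 0 , λ _ _ → ℚₚ.≤-refl)

  -- Three errors vanish in the limit: that of the product in ℤ[γ], that of `o` against `t`, and
  -- that of the reciprocal of `γ + 1` inside `ℓ`.
  lo-null : ∀ t {o} → o ≃ embed t → embed (lo t) ≃ (γ + 1ℝ) * (o - ℓ)
  lo-null t {o} o≃t = null-resp
    (λ n → trans (eq (seq γ n) (seq (embed ((γ̂ ⊕ 1̂) ⊗ t)) n) (seq (embed t) n) (seq o n) (seq [γ+1]⁻¹ n))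
      (cong (ℚ._- seq ((γ + 1ℝ) * (o - ℓ)) n) (sym (expand n))))
    (null-+ (embed-⊗ (γ̂ ⊕ 1̂) t) (null-+ (null-* (bounded (γ + 1ℝ)) (null-swap {seq o} {seq (embed t)} o≃t))
      (null-* (bounded (- γ)) (*-inv (γ + 1ℝ) (1<⇒0<+1 {γ} (tribonacci>1 γ root))))))
    where
    expand : ∀ n → seq (embed (lo t)) n ≡ seq (embed ((γ̂ ⊕ 1̂) ⊗ t)) n ℚ.+ seq γ n
    expand n = trans (eval-⊕ ((γ̂ ⊕ 1̂) ⊗ t) γ̂ (seq γ n))
      (cong (seq (embed ((γ̂ ⊕ 1̂) ⊗ t)) n ℚ.+_) (γ̂-eq (seq γ n)))
      where
      γ̂-eq : ∀ q → 0ℚ ℚ.+ (1ℚ ℚ.* q ℚ.+ 0ℚ ℚ.* (q ℚ.* q)) ≡ q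
      γ̂-eq = solve 1 (λ q → con 0ℚ :+ (con 1ℚ :* q :+ con 0ℚ :* (q :* q)) := q) refl
    eq : ∀ q w e o i →
      (w ℚ.- (1ℚ ℚ.+ (1ℚ ℚ.* q ℚ.+ 0ℚ ℚ.* (q ℚ.* q))) ℚ.* e)
        ℚ.+ ((q ℚ.+ 1ℚ) ℚ.* (e ℚ.- o) ℚ.+ (ℚ.- q) ℚ.* ((q ℚ.+ 1ℚ) ℚ.* i ℚ.- 1ℚ))
      ≡ w ℚ.+ q ℚ.- (q ℚ.+ 1ℚ) ℚ.* (o ℚ.- (ℚ.- q) ℚ.* i)
    eq = solve 5 (λ q w e o i →
      (w :- (con 1ℚ :+ (con 1ℚ :* q :+ con 0ℚ :* (q :* q))) :* e)
        :+ ((q :+ con 1ℚ) :* (e :- o) :+ (:- q) :* ((q :+ con 1ℚ) :* i :- con 1ℚ))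
      := w :+ q :- (q :+ con 1ℚ) :* (o :- (:- q) :* i)) refl

  -- Moves the upper endpoint to the lower one by a translation by 1, so the odd-norm argument
  -- decides both.
  hi-lo : ∀ t → hi t ≡ ⊝ lo (t ⊕ ⊝ 1̂)
  hi-lo = l
    where
    l : ∀ t → 1̂ ⊕ ⊝ ((γ̂ ⊕ 1̂) ⊗ t) ≡ ⊝ ((γ̂ ⊕ 1̂) ⊗ (t ⊕ ⊝ 1̂) ⊕ γ̂)
    l = solve-∀ ℤ[γ]-ring

  hi-dichotomy : ∀ t → Pos (hi t) ⊎ Pos (⊝ hi t)
  hi-dichotomy t = Sum.[ (λ p → inj₂ (subst Pos (trans (neg-neg (lo (t ⊕ ⊝ 1̂))) (cong ⊝_ (sym (hi-lo t)))) p))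
                       , (λ p → inj₁ (subst Pos (sym (hi-lo t)) p)) ]′ (ℓ-dichotomy (t ⊕ ⊝ 1̂))
    where
    neg-neg : ∀ t → t ≡ ⊝ ⊝ t
    neg-neg = solve-∀ ℤ[γ]-ring

  module _ {t o} (o≃t : o ≃ embed t) where

    lo⇒ℓ< : Pos (lo t) → ℓ < o
    lo⇒ℓ< (pos p) = positive⇒< {ℓ} {o} (positive-*-cancelˡ (bounded (γ + 1ℝ)) γ+1-positive
      (positive-resp-null (lo-null t {o} o≃t) p))

    ⊝lo⇒<ℓ : Pos (⊝ lo t) → o < ℓ
    ⊝lo⇒<ℓ (pos p) = positive⇒< {o} {ℓ} (positive-*-cancelˡ (bounded (γ + 1ℝ)) γ+1-positive
      (positive-resp-null null p))
      where
      null : embed (⊝ lo t) ≃ (γ + 1ℝ) * (ℓ - o)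
      null = ≃-trans {embed (⊝ lo t)} { - embed (lo t)} {(γ + 1ℝ) * (ℓ - o)} (embed-⊝ (lo t))
        (≃-trans { - embed (lo t)} { - ((γ + 1ℝ) * (o - ℓ))} {(γ + 1ℝ) * (ℓ - o)}
          (neg-cong {embed (lo t)} {(γ + 1ℝ) * (o - ℓ)} (lo-null t {o} o≃t))
          (≡⇒≃ { - ((γ + 1ℝ) * (o - ℓ))} {(γ + 1ℝ) * (ℓ - o)} (λ n → eq (seq (γ + 1ℝ) n) (seq o n) (seq ℓ n))))
        where
        eq : ∀ g o l → ℚ.- (g ℚ.* (o ℚ.- l)) ≡ g ℚ.* (l ℚ.- o)
        eq = solve 3 (λ g o l → :- (g :* (o :- l)) := g :* (l :- o)) refl

    -- The weak bound becomes strict because the dichotomy leaves no case of equality.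
    ℓ≤⇒lo : ℓ ≤ o → Pos (lo t)
    ℓ≤⇒lo p = Sum.[ (λ q → q) , (λ q → ⊥-elim (≤⇒≯ {ℓ} {o} p (⊝lo⇒<ℓ q))) ]′ (ℓ-dichotomy t)

  module _ {t o} (o≃t : o ≃ embed t) where

    private
      o-1≃ : o - 1ℝ ≃ embed (t ⊕ ⊝ 1̂)
      o-1≃ = null-resp (λ n → cong (λ e → (seq o n ℚ.- 1ℚ) ℚ.- e) (sym (trans (eval-⊕ t (⊝ 1̂) (seq γ n))
          (cong (seq (embed t) n ℚ.+_) (trans (eval-⊝ 1̂ (seq γ n)) (cong ℚ.-_ (eval-κ 1ℤ (seq γ n))))))))
        (null-resp (λ n → eq (seq o n) (seq (embed t) n)) o≃t)
        where
        eq : ∀ o e → o ℚ.- e ≡ (o ℚ.- 1ℚ) ℚ.- (e ℚ.+ ℚ.- 1ℚ)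
        eq = solve 2 (λ o e → o :- e := (o :- con 1ℚ) :- (e :+ :- con 1ℚ)) refl

      unfold : (ℓ - (o - 1ℝ)) ≃ ((ℓ + 1ℝ) - o)
      unfold = ≡⇒≃ {ℓ - (o - 1ℝ)} {(ℓ + 1ℝ) - o} (λ n → eq (seq ℓ n) (seq o n))
        where
        eq : ∀ l o → l ℚ.- (o ℚ.- 1ℚ) ≡ (l ℚ.+ 1ℚ) ℚ.- o
        eq = solve 2 (λ l o → l :- (o :- con 1ℚ) := (l :+ con 1ℚ) :- o) refl

    hi⇒<ℓ+1 : Pos (hi t) → o < ℓ + 1ℝ
    hi⇒<ℓ+1 p = <-shift {o - 1ℝ} {ℓ} {o} {ℓ + 1ℝ} unfold (⊝lo⇒<ℓ {t ⊕ ⊝ 1̂} {o - 1ℝ} o-1≃ (subst Pos (hi-lo t) p))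

    <ℓ+1⇒hi : o < ℓ + 1ℝ → Pos (hi t)
    <ℓ+1⇒hi p = Sum.[ (λ q → q) , (λ q → ⊥-elim (≤⇒≯ {ℓ} {o - 1ℝ}
      (<⇒≤ {ℓ} {o - 1ℝ} (lo⇒ℓ< {t ⊕ ⊝ 1̂} {o - 1ℝ} o-1≃ (subst Pos neg-hi q)))
      (<-shift {o} {ℓ + 1ℝ} {o - 1ℝ} {ℓ} (≃-sym {ℓ - (o - 1ℝ)} {(ℓ + 1ℝ) - o} unfold) p))) ]′ (hi-dichotomy t)
      where
      neg-neg : ∀ t → ⊝ ⊝ t ≡ t
      neg-neg = solve-∀ ℤ[γ]-ring
      neg-hi : ⊝ hi t ≡ lo (t ⊕ ⊝ 1̂)
      neg-hi = trans (cong ⊝_ (hi-lo t)) (neg-neg (lo (t ⊕ ⊝ 1̂)))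

  HalfOpen : ℝ → Set
  HalfOpen o = ℓ ≤ o × o < ℓ + 1ℝ

  halfOpen⇒inside : ∀ {t o} → o ≃ embed t → HalfOpen o → Inside t
  halfOpen⇒inside {t} {o} o≃t (p , q) = ℓ≤⇒lo {t} {o} o≃t p , <ℓ+1⇒hi {t} {o} o≃t q

  inside⇒open : ∀ {t o} → o ≃ embed t → Inside t → InOpenInterval o
  inside⇒open {t} {o} o≃t (p , q) = lo⇒ℓ< {t} {o} o≃t p , hi⇒<ℓ+1 {t} {o} o≃t q

  open⇒halfOpen : ∀ {o} → InOpenInterval o → HalfOpen o
  open⇒halfOpen {o} (p , q) = <⇒≤ {ℓ} {o} p , q

  module _ {o o′ d} (o′≃ : o′ ≃ (- γ) * o - fromℤ d) where

    private
      r : ℝ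
      r = (- γ) * o - ℓ

      lower : (r - fromℤ d) ≃ (o′ - ℓ)
      lower = null-resp (λ n → eq (seq ((- γ) * o) n) (seq ℓ n) (ι d) (seq o′ n))
        (null-swap {seq o′} {seq ((- γ) * o - fromℤ d)} o′≃)
        where
        eq : ∀ p l d o → (p ℚ.- d) ℚ.- o ≡ ((p ℚ.- l) ℚ.- d) ℚ.- (o ℚ.- l)
        eq = solve 4 (λ p l d o → (p :- d) :- o := ((p :- l) :- d) :- (o :- l)) refl

      upper : ((fromℤ d + 1ℝ) - r) ≃ ((ℓ + 1ℝ) - o′)
      upper = null-resp (λ n → eq (seq ((- γ) * o) n) (seq ℓ n) (ι d) (seq o′ n)) o′≃
        where
        eq : ∀ p l d o → o ℚ.- (p ℚ.- d) ≡ ((d ℚ.+ 1ℚ) ℚ.- (p ℚ.- l)) ℚ.- ((l ℚ.+ 1ℚ) ℚ.- o)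
        eq = solve 4 (λ p l d o → o :- (p :- d) := ((d :+ con 1ℚ) :- (p :- l)) :- ((l :+ con 1ℚ) :- o)) refl

    floor⇒halfOpen : IsFloor r d → HalfOpen o′
    floor⇒halfOpen (p , q) = ≤-shift {fromℤ d} {r} {ℓ} {o′} lower p , <-shift {r} {fromℤ d + 1ℝ} {o′} {ℓ + 1ℝ} upper q

    halfOpen⇒floor : HalfOpen o′ → IsFloor r d
    halfOpen⇒floor (p , q) =
        ≤-shift {ℓ} {o′} {fromℤ d} {r} (≃-sym {r - fromℤ d} {o′ - ℓ} lower) p
      , <-shift {o′} {ℓ + 1ℝ} {r} {fromℤ d + 1ℝ} (≃-sym {(fromℤ d + 1ℝ) - r} {(ℓ + 1ℝ) - o′} upper) q

  embed-shift : ∀ t d → embed (shift t d) ≃ (- γ) * embed t - fromℤ d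
  embed-shift t d = null-resp
    (λ n → trans (eq (seq γ n) (seq (embed (γ̂ ⊗ t)) n) (seq (embed t) n) (ι d))
      (cong (ℚ._- seq ((- γ) * embed t - fromℤ d) n) (sym (expand n))))
    (null-swap {seq (embed (γ̂ ⊗ t))} {seq (embed γ̂ * embed t)} (embed-⊗ γ̂ t))
    where
    expand : ∀ n → seq (embed (shift t d)) n ≡ ℚ.- seq (embed (γ̂ ⊗ t)) n ℚ.- ι d
    expand n = trans (eval-⊕ (⊝ (γ̂ ⊗ t)) (⊝ κ d) (seq γ n)) (cong₂ ℚ._+_ (eval-⊝ (γ̂ ⊗ t) (seq γ n))
      (trans (eval-⊝ (κ d) (seq γ n)) (cong ℚ.-_ (eval-κ d (seq γ n)))))
    eq : ∀ q m e d → (0ℚ ℚ.+ (1ℚ ℚ.* q ℚ.+ 0ℚ ℚ.* (q ℚ.* q))) ℚ.* e ℚ.- m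
         ≡ (ℚ.- m ℚ.- d) ℚ.- ((ℚ.- q) ℚ.* e ℚ.- d)
    eq = solve 4 (λ q m e d → (con 0ℚ :+ (con 1ℚ :* q :+ con 0ℚ :* (q :* q))) :* e :- m
         := (:- m :- d) :- ((:- q) :* e :- d)) refl

  -- Orbits whose digits are all zero

  times-γ : ℕ → ℝ → ℝ
  times-γ zero    a = a
  times-γ (suc j) a = (- γ) * times-γ j a

  -- Bernoulli's inequality `(1 + δ)^j ≥ 1 + jδ`, applied to a single term of the sequences.
  times-γ-grows : ∀ {δ n} → 0ℚ ℚ.≤ δ → δ ℚ.+ 1ℚ ℚ.≤ seq γ n → ∀ a j →
    ι (+ j) ℚ.* (δ ℚ.* ∣ seq a n ∣) ℚ.+ ∣ seq a n ∣ ℚ.≤ ∣ seq (times-γ j a) n ∣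
  times-γ-grows {δ} {n} 0≤δ γ≥ a zero = ℚₚ.≤-reflexive
    (solve 2 (λ d a → con 0ℚ :* (d :* a) :+ a := a) refl δ ∣ seq a n ∣)
  times-γ-grows {δ} {n} 0≤δ γ≥ a (suc j) = begin
    ι (+ suc j) ℚ.* δA ℚ.+ A                ≡⟨ cong (λ m → m ℚ.* δA ℚ.+ A) (ι-+ 1ℤ (+ j)) ⟩
    (1ℚ ℚ.+ ι (+ j)) ℚ.* δA ℚ.+ A           ≡⟨ eq₁ (ι (+ j)) δA A ⟩
    δA ℚ.+ G                                ≤⟨ ℚₚ.+-monoˡ-≤ G (ℚₚ.*-monoˡ-≤-nonNeg δ {{ℚ.nonNegative 0≤δ}} A≤G) ⟩
    δ ℚ.* G ℚ.+ G                           ≡⟨ eq₂ δ G ⟩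
    (δ ℚ.+ 1ℚ) ℚ.* G                        ≤⟨ *-mono (ℚₚ.≤-trans 0≤δ+1 γ≥) 0≤G γ≥ (times-γ-grows 0≤δ γ≥ a j) ⟩
    seq γ n ℚ.* ∣ seq (times-γ j a) n ∣      ≤⟨ ℚₚ.*-monoʳ-≤-nonNeg ∣ seq (times-γ j a) n ∣
                                                 {{ℚ.nonNegative (ℚₚ.0≤∣p∣ (seq (times-γ j a) n))}} γ≤∣-γ∣ ⟩
    ∣ ℚ.- seq γ n ∣ ℚ.* ∣ seq (times-γ j a) n ∣ ≡⟨ ℚₚ.∣p*q∣≡∣p∣*∣q∣ (ℚ.- seq γ n) (seq (times-γ j a) n) ⟨
    ∣ seq (times-γ (suc j) a) n ∣            ∎
    where
    open ℚₚ.≤-Reasoning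
    A δA G : ℚ
    A  = ∣ seq a n ∣
    δA = δ ℚ.* A
    G  = ι (+ j) ℚ.* δA ℚ.+ A
    0≤δ+1 : 0ℚ ℚ.≤ δ ℚ.+ 1ℚ
    0≤δ+1 = ℚₚ.+-mono-≤ {0ℚ} {δ} {0ℚ} 0≤δ (ℚₚ.nonNegative⁻¹ 1ℚ)
    A≤G : A ℚ.≤ G
    A≤G = subst (ℚ._≤ G) (ℚₚ.+-identityˡ A) (ℚₚ.+-monoˡ-≤ A
      (*-mono {0ℚ} {ι (+ j)} {0ℚ} (0≤ι j) ℚₚ.≤-refl (0≤ι j) (*-mono {0ℚ} {δ} {0ℚ} 0≤δ ℚₚ.≤-refl 0≤δ (ℚₚ.0≤∣p∣ (seq a n)))))
    0≤G : 0ℚ ℚ.≤ G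
    0≤G = ℚₚ.≤-trans (ℚₚ.0≤∣p∣ (seq a n)) A≤G
    γ≤∣-γ∣ : seq γ n ℚ.≤ ∣ ℚ.- seq γ n ∣
    γ≤∣-γ∣ = subst (seq γ n ℚ.≤_) (sym (ℚₚ.∣-p∣≡∣p∣ (seq γ n))) (p≤∣p∣ (seq γ n))
    eq₁ : ∀ j d a → (1ℚ ℚ.+ j) ℚ.* d ℚ.+ a ≡ d ℚ.+ (j ℚ.* d ℚ.+ a)
    eq₁ = solve 3 (λ j d a → (con 1ℚ :+ j) :* d :+ a := d :+ (j :* d :+ a)) refl
    eq₂ : ∀ d x → d ℚ.* x ℚ.+ x ≡ (d ℚ.+ 1ℚ) ℚ.* x
    eq₂ = solve 2 (λ d x → d :* x :+ x := (d :+ con 1ℚ) :* x) refl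

  bounded-orbit⇒0 : ∀ a C → (∀ j → Eventually λ n → ∣ seq (times-γ j a) n ∣ ℚ.≤ C) → Null (seq a)
  bounded-orbit⇒0 a C h ε 0<ε =
    let δ , 0<δ , γ≥    = tribonacci>1 γ root
        r , 0<r , δε*r≡1 = reciprocal (*-pos 0<δ 0<ε)
        -- `m ≥ C / (δ ε)`, so after `m + 1` multiplications any `|a| > ε` would exceed `C`.
        m , C*r≤m       = archimedean (C ℚ.* r) in
    eventually-zip (λ n γ≥ ≤C → small n 0<δ 0<r δε*r≡1 {m} C*r≤m γ≥ ≤C) γ≥ (h (suc m))
    where
    small : ∀ n {δ r} → 0ℚ ℚ.< δ → 0ℚ ℚ.< r → δ ℚ.* ε ℚ.* r ≡ 1ℚ → ∀ {m} → C ℚ.* r ℚ.≤ ι (+ m) →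
            δ ℚ.+ 1ℚ ℚ.≤ seq γ n → ∣ seq (times-γ (suc m) a) n ∣ ℚ.≤ C → ∣ seq a n ∣ ℚ.≤ ε
    small n {δ} {r} 0<δ 0<r δεr≡1 {m} C*r≤m γ≥ ≤C = ℚₚ.*-cancelˡ-≤-pos (ι +[1+ m ] ℚ.* δ)
      {{ℚ.positive (*-pos 0<sm 0<δ)}} (begin
        ι +[1+ m ] ℚ.* δ ℚ.* A            ≡⟨ ℚₚ.*-assoc (ι +[1+ m ]) δ A ⟩
        ι +[1+ m ] ℚ.* (δ ℚ.* A)          ≡⟨ ℚₚ.+-identityʳ (ι +[1+ m ] ℚ.* (δ ℚ.* A)) ⟨
        ι +[1+ m ] ℚ.* (δ ℚ.* A) ℚ.+ 0ℚ   ≤⟨ ℚₚ.+-monoʳ-≤ (ι +[1+ m ] ℚ.* (δ ℚ.* A)) (ℚₚ.0≤∣p∣ (seq a n)) ⟩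
        ι +[1+ m ] ℚ.* (δ ℚ.* A) ℚ.+ A    ≤⟨ times-γ-grows (ℚₚ.<⇒≤ 0<δ) γ≥ a (suc m) ⟩
        ∣ seq (times-γ (suc m) a) n ∣      ≤⟨ ≤C ⟩
        C                                 ≡⟨ trans (cong (C ℚ.*_) δεr≡1) (ℚₚ.*-identityʳ C) ⟨
        C ℚ.* (δ ℚ.* ε ℚ.* r)             ≡⟨ solve 4 (λ c d e r → c :* (d :* e :* r) := c :* r :* (d :* e)) refl C δ ε r ⟩
        C ℚ.* r ℚ.* (δ ℚ.* ε)             ≤⟨ ℚₚ.*-monoʳ-≤-nonNeg (δ ℚ.* ε) {{ℚ.nonNegative (ℚₚ.<⇒≤ (*-pos 0<δ 0<ε))}}
                                               (ℚₚ.≤-trans C*r≤m m≤sm) ⟩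
        ι +[1+ m ] ℚ.* (δ ℚ.* ε)          ≡⟨ ℚₚ.*-assoc (ι +[1+ m ]) δ ε ⟨
        ι +[1+ m ] ℚ.* δ ℚ.* ε            ∎)
      where
      open ℚₚ.≤-Reasoning
      A : ℚ
      A = ∣ seq a n ∣
      0<sm : 0ℚ ℚ.< ι +[1+ m ]
      0<sm = ℚₚ.<-≤-trans (ℚₚ.positive⁻¹ 1ℚ) (1≤ι m)
      m≤sm : ι (+ m) ℚ.≤ ι +[1+ m ]
      m≤sm = subst₂ ℚ._≤_ (ℚₚ.+-identityˡ (ι (+ m))) (sym (ι-+ 1ℤ (+ m)))
        (ℚₚ.+-monoˡ-≤ (ι (+ m)) (ℚₚ.nonNegative⁻¹ 1ℚ))

  -- The constant is common to all points of the interval; only the index from which it holds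
  -- depends on the point.
  halfOpen-bounded : ∃ λ C → ∀ {o} → HalfOpen o → Eventually λ n → ∣ seq o n ∣ ℚ.≤ C
  halfOpen-bounded =
    let B , _ , ℓ≤B = bounded ℓ in
    B ℚ.+ 1ℚ , λ {o} (p , q) → eventually-zip
      (λ n ℓ≤B (p , q) → bound B {seq ℓ n} {seq o n} ℓ≤B p q)
      ℓ≤B (eventually-zip (λ _ → _,_) (p 1ℚ (ℚₚ.positive⁻¹ 1ℚ)) (below-ℓ+1 o q))
    where
    bound : ∀ B {l o} → ∣ l ∣ ℚ.≤ B → l ℚ.≤ o ℚ.+ 1ℚ → o ℚ.≤ l ℚ.+ 1ℚ → ∣ o ∣ ℚ.≤ B ℚ.+ 1ℚ
    bound B {l} {o} l≤B p q = ∣p∣≤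
      (≤-by (ℚₚ.+-mono-≤ q (ℚₚ.≤-trans (p≤∣p∣ l) l≤B)) (eq₁ o l B))
      (≤-by (ℚₚ.+-mono-≤ p (ℚₚ.≤-trans (-p≤∣p∣ l) l≤B)) (eq₂ o l B))
      where
      eq₁ : ∀ o l b → l ℚ.+ 1ℚ ℚ.+ b ℚ.- (o ℚ.+ l) ≡ (b ℚ.+ 1ℚ) ℚ.- o
      eq₁ = solve 3 (λ o l b → l :+ con 1ℚ :+ b :- (o :+ l) := (b :+ con 1ℚ) :- o) refl
      eq₂ : ∀ o l b → o ℚ.+ 1ℚ ℚ.+ b ℚ.- (l ℚ.+ ℚ.- l) ≡ (b ℚ.+ 1ℚ) ℚ.- ℚ.- o
      eq₂ = solve 3 (λ o l b → o :+ con 1ℚ :+ b :- (l :+ :- l) := (b :+ con 1ℚ) :- :- o) refl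

    below-ℓ+1 : ∀ o → o < ℓ + 1ℝ → Eventually λ n → seq o n ℚ.≤ seq ℓ n ℚ.+ 1ℚ
    below-ℓ+1 o (ε , 0<ε , h) = eventually-map
      (λ n h → ℚₚ.≤-trans (subst (ℚ._≤ ε ℚ.+ seq o n) (ℚₚ.+-identityˡ (seq o n)) (ℚₚ.+-monoˡ-≤ (seq o n) (ℚₚ.<⇒≤ 0<ε))) h) h

  record Orbit (o : ℕ → ℝ) (d : ℕ → ℤ) : Set where
    field
      halfOpen : ∀ i → HalfOpen (o i)
      next     : ∀ i → o (suc i) ≃ (- γ) * o i - fromℤ (d i)


  open Orbit

  -- With zero digits `T` is multiplication by `−γ`, and a nonzero point would leave the bounded
  -- interval. The 1 added to `C` absorbs the distance between `o j` and `times-γ j (o 0)`.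
  zero-digits⇒0 : ∀ {o d} → Orbit o d → (∀ i → d i ≡ 0ℤ) → Null (seq (o 0))
  zero-digits⇒0 {o} {d} orb d≡0 =
    let C , ≤C = halfOpen-bounded in
    bounded-orbit⇒0 (o 0) (1ℚ ℚ.+ C) (λ j → eventually-zip
    (λ n close o≤C → ℚₚ.≤-trans (triangle (seq (times-γ j (o 0)) n) (seq (o j) n)) (ℚₚ.+-mono-≤ close o≤C))
    (orbit≃ j 1ℚ (ℚₚ.positive⁻¹ 1ℚ)) (≤C {o j} (halfOpen orb j)))
    where
    triangle : ∀ p q → ∣ p ∣ ℚ.≤ ∣ p ℚ.- q ∣ ℚ.+ ∣ q ∣
    triangle p q = subst (λ r → ∣ r ∣ ℚ.≤ ∣ p ℚ.- q ∣ ℚ.+ ∣ q ∣)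
      (solve 2 (λ p q → (p :- q) :+ q := p) refl p q) (ℚₚ.∣p+q∣≤∣p∣+∣q∣ (p ℚ.- q) q)

    orbit≃ : ∀ j → times-γ j (o 0) ≃ o j
    orbit≃ zero    = ≃-refl {o 0}
    orbit≃ (suc j) = ≃-trans {times-γ (suc j) (o 0)} {(- γ) * o j} {o (suc j)}
      (*-congˡ (- γ) {times-γ j (o 0)} {o j} (orbit≃ j))
      (≃-trans {(- γ) * o j} {(- γ) * o j - fromℤ (d j)} {o (suc j)}
        (≡⇒≃ {(- γ) * o j} {(- γ) * o j - fromℤ (d j)} (λ n → trans (sym (ℚₚ.+-identityʳ _))
          (cong (λ e → seq ((- γ) * o j) n ℚ.- ι e) (sym (d≡0 j)))))
        (≃-sym {o (suc j)} {(- γ) * o j - fromℤ (d j)} (next orb j)))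

  -- Combining the bounds on both points gives `−1 < d < γ < 2`.
  inside-digit : ∀ t d → Inside t → Inside (shift t d) → ∃ λ b → d ≡ ⟦ b ⟧
  inside-digit t d (p , q) (p′ , q′) = bit d (pos-κ (1ℤ ℤ.+ d) 1+d>0) (pos-κ (+ 2 ℤ.- d) 2-d>0)
    where
    lower : ∀ t d → hi (⊝ (γ̂ ⊗ t) ⊕ ⊝ d) ⊕ γ̂ ⊗ hi t ≡ (γ̂ ⊕ 1̂) ⊗ (1̂ ⊕ d)
    lower = l
      where
      l : ∀ t d → (1̂ ⊕ ⊝ ((γ̂ ⊕ 1̂) ⊗ (⊝ (γ̂ ⊗ t) ⊕ ⊝ d))) ⊕ γ̂ ⊗ (1̂ ⊕ ⊝ ((γ̂ ⊕ 1̂) ⊗ t)) ≡ (γ̂ ⊕ 1̂) ⊗ (1̂ ⊕ d)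
      l = solve-∀ ℤ[γ]-ring
    upper : ∀ t d → lo (⊝ (γ̂ ⊗ t) ⊕ ⊝ d) ⊕ γ̂ ⊗ lo t ≡ (γ̂ ⊕ 1̂) ⊗ (γ̂ ⊕ ⊝ d)
    upper = l
      where
      l : ∀ t d → ((γ̂ ⊕ 1̂) ⊗ (⊝ (γ̂ ⊗ t) ⊕ ⊝ d) ⊕ γ̂) ⊕ γ̂ ⊗ ((γ̂ ⊕ 1̂) ⊗ t ⊕ γ̂) ≡ (γ̂ ⊕ 1̂) ⊗ (γ̂ ⊕ ⊝ d)
      l = solve-∀ ℤ[γ]-ring
    1+d>0 : Pos (κ (1ℤ ℤ.+ d))
    1+d>0 = pos-⊗-cancelˡ (γ̂ ⊕ 1̂) (1̂ ⊕ κ d) (positive! (γ̂ ⊕ 1̂)) (subst Pos (lower t (κ d))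
      (pos-⊕ (hi (shift t d)) (γ̂ ⊗ hi t) q′ (pos-⊗ γ̂ (hi t) pos-γ̂ q)))
    γ-d>0 : Pos (γ̂ ⊕ ⊝ κ d)
    γ-d>0 = pos-⊗-cancelˡ (γ̂ ⊕ 1̂) (γ̂ ⊕ ⊝ κ d) (positive! (γ̂ ⊕ 1̂)) (subst Pos (upper t (κ d))
      (pos-⊕ (lo (shift t d)) (γ̂ ⊗ lo t) p′ (pos-⊗ γ̂ (lo t) pos-γ̂ p)))
    2-d>0 : Pos (κ (+ 2 ℤ.- d))
    2-d>0 = subst Pos (l (κ d)) (pos-⊕ (1̂ ⊕ 1̂ ⊕ ⊝ γ̂) (γ̂ ⊕ ⊝ κ d) (positive! (1̂ ⊕ 1̂ ⊕ ⊝ γ̂)) γ-d>0)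
      where
      l : ∀ d → (1̂ ⊕ 1̂ ⊕ ⊝ γ̂) ⊕ (γ̂ ⊕ ⊝ d) ≡ 1̂ ⊕ 1̂ ⊕ ⊝ d
      l = solve-∀ ℤ[γ]-ring
    bit : ∀ d → (∃ λ m → 1ℤ ℤ.+ d ≡ +[1+ m ]) → (∃ λ m → + 2 ℤ.- d ≡ +[1+ m ]) → ∃ λ b → d ≡ ⟦ b ⟧
    bit (+ 0)                 _        _        = false , refl
    bit (+ 1)                 _        _        = true , refl
    bit (+ 2)                 _        (_ , ())
    bit (+ suc (suc (suc d))) _        (_ , ())
    bit -[1+ 0 ]              (_ , ()) _
    bit -[1+ suc d ]          (_ , ()) _

  -- ℤ₋ᵦ and Reach

  private
    γ*γ⁻¹≃1 : γ * γ⁻¹ ≃ 1ℝ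
    γ*γ⁻¹≃1 = *-inv γ (1<⇒0< {γ} (tribonacci>1 γ root))

  embed-unshift : ∀ t → embed (unshift t) ≃ embed t * (- γ⁻¹)
  embed-unshift t = null-resp
    (λ n → eq (seq γ n) (seq γ⁻¹ n) (seq (embed t) n) (seq (embed (unshift t)) n))
    (null-+ (null-* (bounded γ⁻¹) e≃) (null-* (bounded (- embed (unshift t))) γ*γ⁻¹≃1))
    where
    e≃ : embed t ≃ (- γ) * embed (unshift t) - fromℤ 0ℤ
    e≃ = subst (λ v → embed v ≃ (- γ) * embed (unshift t) - fromℤ 0ℤ) (shift-unshift t) (embed-shift (unshift t) 0ℤ)
    eq : ∀ g i e u → i ℚ.* (e ℚ.- ((ℚ.- g) ℚ.* u ℚ.- 0ℚ)) ℚ.+ (ℚ.- u) ℚ.* (g ℚ.* i ℚ.- 1ℚ) ≡ u ℚ.- e ℚ.* (ℚ.- i)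
    eq = solve 4 (λ g i e u → i :* (e :- ((:- g) :* u :- con 0ℚ)) :+ (:- u) :* (g :* i :- con 1ℚ) := u :- e :* (:- i)) refl

  unshifts : ℕ → ℤ[γ] → ℤ[γ]
  unshifts zero    w = w
  unshifts (suc k) w = unshift (unshifts k w)

  embed-unshifts : ∀ k {z} w → z ≃ embed w → z /[-β]^ k ≃ embed (unshifts k w)
  embed-unshifts zero {z} w z≃w = ≃-trans {z * 1ℝ} {z} {embed w}
    (≡⇒≃ {z * 1ℝ} {z} (λ n → ℚₚ.*-identityʳ (seq z n))) z≃w
  embed-unshifts (suc k) {z} w z≃w =
    ≃-trans {z /[-β]^ suc k} {(z /[-β]^ k) * (- γ⁻¹)} {embed (unshifts (suc k) w)}
      (≡⇒≃ {z /[-β]^ suc k} {(z /[-β]^ k) * (- γ⁻¹)} (λ n → eq (seq z n) (seq (- γ⁻¹) n) (seq ((- γ⁻¹) ^ k) n)))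
      (≃-trans {(z /[-β]^ k) * (- γ⁻¹)} {embed (unshifts k w) * (- γ⁻¹)} {embed (unshifts (suc k) w)}
        (*-congʳ (- γ⁻¹) {z /[-β]^ k} {embed (unshifts k w)} (embed-unshifts k {z} w z≃w))
        (≃-sym {embed (unshifts (suc k) w)} {embed (unshifts k w) * (- γ⁻¹)} (embed-unshift (unshifts k w))))
    where
    eq : ∀ z i p → z ℚ.* (i ℚ.* p) ≡ (z ℚ.* p) ℚ.* i
    eq = solve 3 (λ z i p → z :* (i :* p) := (z :* p) :* i) refl

  /[-β]^-null : ∀ k {z} → Null (seq (z /[-β]^ k)) → Null (seq z)
  /[-β]^-null zero    {z} h = null-resp (λ n → ℚₚ.*-identityʳ (seq z n)) h
  /[-β]^-null (suc k) {z} h = /[-β]^-null k {z} (null-resp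
    (λ n → eq (seq γ n) (seq γ⁻¹ n) (seq z n) (seq ((- γ⁻¹) ^ k) n))
    (null-+ (null-* (bounded (- γ)) h) (null-* (bounded (- (z /[-β]^ k))) γ*γ⁻¹≃1)))
    where
    eq : ∀ g i z p → (ℚ.- g) ℚ.* (z ℚ.* ((ℚ.- i) ℚ.* p)) ℚ.+ (ℚ.- (z ℚ.* p)) ℚ.* (g ℚ.* i ℚ.- 1ℚ) ≡ z ℚ.* p
    eq = solve 4 (λ g i z p → (:- g) :* (z :* ((:- i) :* p)) :+ (:- (z :* p)) :* (g :* i :- con 1ℚ) := z :* p) refl

  /[-β]^-injective : ∀ k {x y} → x /[-β]^ k ≃ y /[-β]^ k → x ≃ y
  /[-β]^-injective k {x} {y} h = /[-β]^-null k {x - y} (null-resp (λ n → eq (seq x n) (seq y n) (seq ((- γ⁻¹) ^ k) n)) h)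
    where
    eq : ∀ x y p → x ℚ.* p ℚ.- y ℚ.* p ≡ (x ℚ.- y) ℚ.* p
    eq = solve 3 (λ x y p → x :* p :- y :* p := (x :- y) :* p) refl

  shifts : ℕ → ℤ[γ] → ℤ[γ]
  shifts zero    t = t
  shifts (suc k) t = shift (shifts k t) 0ℤ

  unshifts-shift : ∀ k t → unshifts (suc k) (shift t 0ℤ) ≡ unshifts k t
  unshifts-shift zero    t = unshift-shift t
  unshifts-shift (suc k) t = cong unshift (unshifts-shift k t)

  unshifts-shifts : ∀ k m t → unshifts (k ℕ.+ m) (shifts k t) ≡ unshifts m t
  unshifts-shifts zero    m t = refl
  unshifts-shifts (suc k) m t = trans (unshifts-shift (k ℕ.+ m) (shifts k t)) (unshifts-shifts k m t)

  previous-shift : ∀ t d → shift (unshift (t ⊕ κ d)) d ≡ t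
  previous-shift t d = l t (κ d)
    where
    l : ∀ t d → ⊝ (γ̂ ⊗ (⊝ (γ̂⁻¹ ⊗ (t ⊕ d)))) ⊕ ⊝ d ≡ t
    l = solve-∀ ℤ[γ]-ring

  previous : ∀ {t o o′ d} → o′ ≃ embed t → o′ ≃ (- γ) * o - fromℤ d → o ≃ embed (unshift (t ⊕ κ d))
  previous {t} {o} {o′} {d} o′≃t o′≃ = null-*-cancelˡ γ-positive (null-resp
    (λ n → eq (seq γ n) (seq o n) (seq (embed u) n) (seq o′ n) (ι d))
    (null-+ (null-swap {seq o′} {seq ((- γ) * embed u - fromℤ d)} o′≃u) o′≃))
    where
    u : ℤ[γ]
    u = unshift (t ⊕ κ d)
    o′≃u : o′ ≃ (- γ) * embed u - fromℤ d
    o′≃u = ≃-trans {o′} {embed t} {(- γ) * embed u - fromℤ d} o′≃t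
      (subst (λ v → embed v ≃ (- γ) * embed u - fromℤ d) (previous-shift t d) (embed-shift u d))
    eq : ∀ g o u o′ d → (((ℚ.- g) ℚ.* u ℚ.- d) ℚ.- o′) ℚ.+ (o′ ℚ.- ((ℚ.- g) ℚ.* o ℚ.- d)) ≡ g ℚ.* (o ℚ.- u)
    eq = solve 5 (λ g o u o′ d → (((:- g) :* u :- d) :- o′) :+ (o′ :- ((:- g) :* o :- d)) := g :* (o :- u)) refl

  tail : ∀ {o d} → Orbit o d → Orbit (λ i → o (suc i)) (λ i → d (suc i))
  tail orb = record { halfOpen = λ i → halfOpen orb (suc i) ; next = λ i → next orb (suc i) }

  -- The real orbit is identified from its end: it is 0 once only zero digits remain, and `previous`
  -- pulls the triple back through one digit at a time.
  orbit⇒reach : ∀ k {o d} → Orbit o d → (∀ j → d (k ℕ.+ j) ≡ 0ℤ) → ∃ λ t → o 0 ≃ embed t × Reach k t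
  orbit⇒reach zero {o} orb d≡0 = 0̂ , o≃0 , done
    where
    o≃0 : o 0 ≃ embed 0̂
    o≃0 = null-resp (λ n → trans (sym (ℚₚ.+-identityʳ (seq (o 0) n)))
      (cong (λ e → seq (o 0) n ℚ.- e) (sym (eval-κ 0ℤ (seq γ n))))) (zero-digits⇒0 orb d≡0)
  orbit⇒reach (suc k) {o} {d} orb d≡0 =
    let t , o′≃t , r = orbit⇒reach k (tail orb) d≡0
        u            = unshift (t ⊕ κ (d 0))
        o≃u          = previous {t} {o 0} {o 1} {d 0} o′≃t (next orb 0)
        inside       = halfOpen⇒inside {u} {o 0} o≃u (halfOpen orb 0)
        shift-u      = previous-shift t (d 0)
        b , d≡b      = inside-digit u (d 0) inside (subst Inside (sym shift-u) (reach⇒inside r)) in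
    u , o≃u , step b inside (subst (Reach k) (trans (sym shift-u) (cong (shift u) d≡b)) r)

  -- Without minimality of `k`, so that two integers can be padded to a common length.
  Integer : ℤ[γ] → Set
  Integer w = ∃ λ k → Reach k (unshifts k w)

  ℤ₋ᵦ⇒integer : ∀ {x} → ℤ₋ᵦ x → ∃ λ w → x ≃ embed w × Integer w
  ℤ₋ᵦ⇒integer {x} (e , fractional≡0) =
    let t , o₀≃t , r = orbit⇒reach k orb fractional≡0
        w            = shifts k t
        unshifts-w   = trans (cong (λ m → unshifts m w) (sym (ℕₚ.+-identityʳ k))) (unshifts-shifts k 0 t) in
    w ,
    /[-β]^-injective k {x} {embed w}
      (≃-trans {x /[-β]^ k} {embed t} {embed w /[-β]^ k}
        (≃-trans {x /[-β]^ k} {orbit 0} {embed t} (≃-sym {orbit 0} {x /[-β]^ k} orbit-zero) o₀≃t)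
        (subst (λ v → embed v ≃ embed w /[-β]^ k) unshifts-w
          (≃-sym {embed w /[-β]^ k} {embed (unshifts k w)} (embed-unshifts k {embed w} w (≃-refl {embed w}))))) ,
    k , subst (Reach k) (sym unshifts-w) r
    where
    open Expansion e
    open IsDigitSequence isDigits
    halfOpen-resp : ∀ {o o′} → o ≃ o′ → HalfOpen o → HalfOpen o′
    halfOpen-resp {o} {o′} o≃o′ (p , q) =
        ≤-shift {ℓ} {o} {ℓ} {o′} (+-cong {o} {o′} { - ℓ} { - ℓ} o≃o′ (≃-refl { - ℓ})) p
      , <-shift {o} {ℓ + 1ℝ} {o′} {ℓ + 1ℝ}
          (+-cong {ℓ + 1ℝ} {ℓ + 1ℝ} { - o} { - o′} (≃-refl {ℓ + 1ℝ}) (neg-cong {o} {o′} o≃o′)) q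
    orb : Orbit orbit digit
    orb = record
      { halfOpen = λ
        { zero    → halfOpen-resp {x /[-β]^ k} {orbit 0} (≃-sym {orbit 0} {x /[-β]^ k} orbit-zero)
                      (open⇒halfOpen {x /[-β]^ k} inside)
        ; (suc i) → floor⇒halfOpen {orbit i} {orbit (suc i)} {digit i} (orbit-suc i) (digit-floor i) }
      ; next = orbit-suc }

  reach-digit : ∀ {m t} → Reach m t → ℕ → ℤ
  reach-digit done         _       = 0ℤ
  reach-digit (step b _ _) zero    = ⟦ b ⟧
  reach-digit (step _ _ r) (suc i) = reach-digit r i

  reach-orbit : ∀ {m t} → Reach m t → ℕ → ℤ[γ]
  reach-orbit done             _       = 0̂
  reach-orbit (step {t = t} _ _ _) zero = t
  reach-orbit (step _ _ r)     (suc i) = reach-orbit r i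

  reach-orbit-zero : ∀ {m t} (r : Reach m t) → reach-orbit r 0 ≡ t
  reach-orbit-zero done         = refl
  reach-orbit-zero (step _ _ _) = refl

  reach-orbit-suc : ∀ {m t} (r : Reach m t) i →
                    reach-orbit r (suc i) ≡ shift (reach-orbit r i) (reach-digit r i)
  reach-orbit-suc done         i       = refl
  reach-orbit-suc (step _ _ r) zero    = reach-orbit-zero r
  reach-orbit-suc (step _ _ r) (suc i) = reach-orbit-suc r i

  reach-orbit-inside : ∀ {m t} (r : Reach m t) i → Inside (reach-orbit r i)
  reach-orbit-inside done         i       = reach⇒inside done
  reach-orbit-inside (step _ i _) zero    = i
  reach-orbit-inside (step _ _ r) (suc i) = reach-orbit-inside r i

  reach-digit-zero : ∀ {m t} (r : Reach m t) {i} → m ℕ.≤ i → reach-digit r i ≡ 0ℤ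
  reach-digit-zero done         _           = refl
  reach-digit-zero (step _ _ r) (ℕ.s≤s m≤i) = reach-digit-zero r m≤i

  reach⇒digits : ∀ {m t x} → x ≃ embed t → (r : Reach m t) → IsDigitSequence x (reach-digit r)
  reach⇒digits {m} {t} {x} x≃t r = record
    { orbit       = λ i → embed (o i)
    ; orbit-zero  = subst (λ u → embed u ≃ x) (sym (reach-orbit-zero r)) (≃-sym {x} {embed t} x≃t)
    ; digit-floor = λ i → halfOpen⇒floor {embed (o i)} {embed (o (suc i))} {d i} (orbit-suc i)
        (open⇒halfOpen {embed (o (suc i))} (inside⇒open {o (suc i)} {embed (o (suc i))}
          (≃-refl {embed (o (suc i))}) (reach-orbit-inside r (suc i))))
    ; orbit-suc   = orbit-suc }
    where
    o = reach-orbit r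
    d = reach-digit r
    orbit-suc : ∀ i → embed (o (suc i)) ≃ (- γ) * embed (o i) - fromℤ (d i)
    orbit-suc i = subst (λ u → embed u ≃ (- γ) * embed (o i) - fromℤ (d i)) (sym (reach-orbit-suc r i)) (embed-shift (o i) (d i))

  -- Expansions with the minimal number of integer digits

  inside? : ∀ t → Inside t ⊎ ¬ Inside t
  inside? t = Sum.[ (λ p → Sum.[ (λ q → inj₁ (p , q)) , (λ q → inj₂ λ (_ , q′) → pos-asym (hi t) q′ q) ]′
                              (hi-dichotomy t))
                  , (λ p → inj₂ λ (p′ , _) → pos-asym (lo t) p′ p) ]′ (ℓ-dichotomy t)

  unshifts-inside-mono : ∀ {j k w} → j ℕ.≤′ k → Inside (unshifts j w) → Inside (unshifts k w)
  unshifts-inside-mono (ℕ.≤′-reflexive refl) i = i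
  unshifts-inside-mono {w = w} (ℕ.≤′-step {k} j≤k) i = inside-unshift (unshifts k w) (unshifts-inside-mono j≤k i)

  unshifts-reach-mono : ∀ {j k w} → j ℕ.≤′ k → Reach j (unshifts j w) → Reach k (unshifts k w)
  unshifts-reach-mono (ℕ.≤′-reflexive refl) r = r
  unshifts-reach-mono {w = w} (ℕ.≤′-step {k} j≤k) r = reach-unshift (unshifts k w) (unshifts-reach-mono j≤k r)

  MinimalReach : ℕ → ℤ[γ] → Set
  MinimalReach n w = ∃ λ k → Reach (k ℕ.+ n) (unshifts k w) × (∀ j → j ℕ.< k → ¬ Inside (unshifts j w))

  -- Leading zeros are stripped while the previous quotient is still inside. At the first one
  -- outside, all smaller exponents are outside too, since being inside persists under further
  -- division.
  minimal-reach : ∀ {n} K w → Reach (K ℕ.+ n) (unshifts K w) → MinimalReach n w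
  minimal-reach zero    w r = 0 , r , λ _ ()
  minimal-reach {n} (suc K) w r = Sum.[
      (λ i → minimal-reach K w (subst (Reach (K ℕ.+ n)) (shift-unshift (unshifts K w))
        (reach-shift (unshifts (suc K) w) (subst Inside (sym (shift-unshift (unshifts K w))) i) r)))
    , (λ ¬i → suc K , r , λ j j<k i → ¬i (unshifts-inside-mono (ℕₚ.≤⇒≤′ (ℕₚ.≤-pred j<k)) i))
    ]′ (inside? (unshifts K w))

  FractionalZeroFrom : ℕ → ∀ {z} → Expansion z → Set
  FractionalZeroFrom n e = ∀ j → n ℕ.≤ j → Expansion.fractionalDigit e j ≡ 0ℤ

  reach⇒expansion : ∀ {n z w} → z ≃ embed w → ∀ K → Reach (K ℕ.+ n) (unshifts K w) →
                    Σ (Expansion z) (FractionalZeroFrom n)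
  reach⇒expansion {n} {z} {w} z≃w K r =
    let k , s , minimal = minimal-reach K w r in
    record
      { k         = k
      ; inside    = inside⇒open {unshifts k w} {z /[-β]^ k} (z≃ k) (reach⇒inside s)
      ; k-minimal = λ j j<k i → minimal j j<k
          (halfOpen⇒inside {unshifts j w} {z /[-β]^ j} (z≃ j) (open⇒halfOpen {z /[-β]^ j} i))
      ; digit     = reach-digit s
      ; isDigits  = reach⇒digits {x = z /[-β]^ k} (z≃ k) s }
    , λ j n≤j → reach-digit-zero s (ℕₚ.+-monoʳ-≤ k n≤j)
    where
    z≃ : ∀ k → z /[-β]^ k ≃ embed (unshifts k w)
    z≃ k = embed-unshifts k {z} w z≃w

  -- `IsFr` asks for the exact place of the last nonzero digit, so the bound `n` is lowered past
  -- zeros by the decidable equality of integer digits.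
  last-digit : ∀ {z} → Fin₋ᵦ z → (e : Expansion z) → ∀ n → FractionalZeroFrom n e →
               ∃ λ m → m ℕ.≤ n × IsFr z [ m ]
  last-digit fin e zero    zeros = 0 , ℕ.z≤n , integral fin e λ j → zeros j ℕ.z≤n
  last-digit fin e (suc n) zeros with Expansion.fractionalDigit e n ℤₚ.≟ 0ℤ
  ... | no  d≢0 = suc n , ℕₚ.≤-refl , fractional fin e n d≢0 zeros
  ... | yes d≡0 =
    let m , m≤n , isFr = last-digit fin e n λ j n≤j → zeros′ j (ℕₚ.m≤n⇒m<n∨m≡n n≤j) in
    m , ℕₚ.m≤n⇒m≤1+n m≤n , isFr
    where
    zeros′ : ∀ j → n ℕ.< j ⊎ n ≡ j → Expansion.fractionalDigit e j ≡ 0ℤ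
    zeros′ j (inj₁ n<j)  = zeros j n<j
    zeros′ j (inj₂ refl) = d≡0

  reach⇒finite : ∀ {n z w} → z ≃ embed w → ∀ K → Reach (K ℕ.+ n) (unshifts K w) → Fin₋ᵦ z
  reach⇒finite {n} {z} {w} z≃w K r =
    -- The witness is `(−γ)ⁿ z`: moving the radix point `n` places turns the fractional digits into
    -- integer digits.
    n , embed w′ , (let e , zeros = integer in e , λ j → zeros j ℕ.z≤n) ,
    ≃-trans {z} {embed w} {embed w′ /[-β]^ n} z≃w
      (subst (λ v → embed v ≃ embed w′ /[-β]^ n) unshifts-w′
        (≃-sym {embed w′ /[-β]^ n} {embed (unshifts n w′)} (embed-unshifts n {embed w′} w′ (≃-refl {embed w′}))))
    where
    w′ : ℤ[γ]
    w′ = shifts n w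
    unshifts-w′ : unshifts n w′ ≡ w
    unshifts-w′ = trans (cong (λ m → unshifts m w′) (sym (ℕₚ.+-identityʳ n))) (unshifts-shifts n 0 w)
    integer : Σ (Expansion (embed w′)) (FractionalZeroFrom 0)
    integer = reach⇒expansion {w = w′} (≃-refl {embed w′}) (n ℕ.+ K)
      (subst₂ Reach (trans (ℕₚ.+-comm K n) (sym (ℕₚ.+-identityʳ (n ℕ.+ K)))) (sym (unshifts-shifts n K w)) r)

  reach⇒fr≤ : ∀ {n z w} → z ≃ embed w → ∀ K → Reach (K ℕ.+ n) (unshifts K w) → fr[ z ]≤ n
  reach⇒fr≤ {n} {z} {w} z≃w K r =
    let e , zeros = reach⇒expansion {n} {z} {w} z≃w K r
        m , m≤n , isFr = last-digit (reach⇒finite {n} {z} {w} z≃w K r) e n zeros in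
    [ m ] , isFr , [ m≤n ]

  -- Sums and differences of two integers

  unshift-⊕ : ∀ x y → unshift (x ⊕ y) ≡ unshift x ⊕ unshift y
  unshift-⊕ = l
    where
    l : ∀ x y → ⊝ (γ̂⁻¹ ⊗ (x ⊕ y)) ≡ ⊝ (γ̂⁻¹ ⊗ x) ⊕ ⊝ (γ̂⁻¹ ⊗ y)
    l = solve-∀ ℤ[γ]-ring

  unshift-⊝ : ∀ x → unshift (⊝ x) ≡ ⊝ unshift x
  unshift-⊝ = l
    where
    l : ∀ x → ⊝ (γ̂⁻¹ ⊗ (⊝ x)) ≡ ⊝ (⊝ (γ̂⁻¹ ⊗ x))
    l = solve-∀ ℤ[γ]-ring

  unshifts-⊕ : ∀ k x y → unshifts k (x ⊕ y) ≡ unshifts k x ⊕ unshifts k y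
  unshifts-⊕ zero    x y = refl
  unshifts-⊕ (suc k) x y = trans (cong unshift (unshifts-⊕ k x y)) (unshift-⊕ (unshifts k x) (unshifts k y))

  unshifts-⊝ : ∀ k x → unshifts k (⊝ x) ≡ ⊝ unshifts k x
  unshifts-⊝ zero    x = refl
  unshifts-⊝ (suc k) x = trans (cong unshift (unshifts-⊝ k x)) (unshift-⊝ (unshifts k x))

  private
    γ̂² γ̂³ : ℤ[γ]
    γ̂² = γ̂ ⊗ γ̂
    γ̂³ = γ̂ ⊗ γ̂²

    shift² : ℤ[γ] → ℤ[γ]
    shift² t = shift (shift t 0ℤ) 0ℤ

    scaled : ∀ p a b c → a ⊕ b ⊕ c ≡ γ̂² ⊗ p → Pos a → Pos b → Pos c → Pos p
    scaled p a b c eq pa pb pc = pos-⊗-cancelˡ γ̂² p (pos-⊗ γ̂ γ̂ pos-γ̂ pos-γ̂)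
      (subst Pos eq (pos-⊕ (a ⊕ b) c (pos-⊕ a b pa pb) pc))

  -- Since `γ² > 2`, two divisions by `−γ` shrink the interval enough for the sum to fit; the slacks
  -- are `γ (γ² − 2)` and `γ² − 2`.
  inside-sum : ∀ a b → Inside (shift² a) → Inside (shift² b) → Inside (a ⊕ b)
  inside-sum a b (la , ha) (lb , hb) =
      scaled (lo (a ⊕ b)) (lo (shift² a)) (lo (shift² b)) (γ̂³ ⊕ ⊝ γ̂ ⊕ ⊝ γ̂) (eq₁ a b)
        la lb (positive! (γ̂³ ⊕ ⊝ γ̂ ⊕ ⊝ γ̂))
    , scaled (hi (a ⊕ b)) (hi (shift² a)) (hi (shift² b)) (γ̂² ⊕ ⊝ 1̂ ⊕ ⊝ 1̂) (eq₂ a b)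
        ha hb (positive! (γ̂² ⊕ ⊝ 1̂ ⊕ ⊝ 1̂))
    where
    eq₁ : ∀ a b → lo (shift² a) ⊕ lo (shift² b) ⊕ (γ̂³ ⊕ ⊝ γ̂ ⊕ ⊝ γ̂) ≡ γ̂² ⊗ lo (a ⊕ b)
    eq₁ = l
      where
      l : ∀ a b → ((γ̂ ⊕ 1̂) ⊗ (⊝ (γ̂ ⊗ (⊝ (γ̂ ⊗ a) ⊕ ⊝ 0̂)) ⊕ ⊝ 0̂) ⊕ γ̂)
          ⊕ ((γ̂ ⊕ 1̂) ⊗ (⊝ (γ̂ ⊗ (⊝ (γ̂ ⊗ b) ⊕ ⊝ 0̂)) ⊕ ⊝ 0̂) ⊕ γ̂)
          ⊕ (γ̂ ⊗ (γ̂ ⊗ γ̂) ⊕ ⊝ γ̂ ⊕ ⊝ γ̂) ≡ (γ̂ ⊗ γ̂) ⊗ ((γ̂ ⊕ 1̂) ⊗ (a ⊕ b) ⊕ γ̂)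
      l = solve-∀ ℤ[γ]-ring
    eq₂ : ∀ a b → hi (shift² a) ⊕ hi (shift² b) ⊕ (γ̂² ⊕ ⊝ 1̂ ⊕ ⊝ 1̂) ≡ γ̂² ⊗ hi (a ⊕ b)
    eq₂ = l
      where
      l : ∀ a b → (1̂ ⊕ ⊝ ((γ̂ ⊕ 1̂) ⊗ (⊝ (γ̂ ⊗ (⊝ (γ̂ ⊗ a) ⊕ ⊝ 0̂)) ⊕ ⊝ 0̂)))
          ⊕ (1̂ ⊕ ⊝ ((γ̂ ⊕ 1̂) ⊗ (⊝ (γ̂ ⊗ (⊝ (γ̂ ⊗ b) ⊕ ⊝ 0̂)) ⊕ ⊝ 0̂)))
          ⊕ (γ̂ ⊗ γ̂ ⊕ ⊝ 1̂ ⊕ ⊝ 1̂) ≡ (γ̂ ⊗ γ̂) ⊗ (1̂ ⊕ ⊝ ((γ̂ ⊕ 1̂) ⊗ (a ⊕ b)))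
      l = solve-∀ ℤ[γ]-ring

  -- Subtraction pairs the lower end for `a` with the upper end for `b` and conversely. The slacks
  -- become `γ³ − γ − 1` and `γ² − γ − 1 = γ⁻¹`.
  inside-difference : ∀ a b → Inside (shift² a) → Inside (shift² b) → Inside (a ⊕ ⊝ b)
  inside-difference a b (la , ha) (lb , hb) =
      scaled (lo (a ⊕ ⊝ b)) (lo (shift² a)) (hi (shift² b)) (γ̂³ ⊕ ⊝ γ̂ ⊕ ⊝ 1̂) (eq₁ a b)
        la hb (positive! (γ̂³ ⊕ ⊝ γ̂ ⊕ ⊝ 1̂))
    , scaled (hi (a ⊕ ⊝ b)) (hi (shift² a)) (lo (shift² b)) (γ̂² ⊕ ⊝ γ̂ ⊕ ⊝ 1̂) (eq₂ a b)
        ha lb (positive! (γ̂² ⊕ ⊝ γ̂ ⊕ ⊝ 1̂))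
    where
    eq₁ : ∀ a b → lo (shift² a) ⊕ hi (shift² b) ⊕ (γ̂³ ⊕ ⊝ γ̂ ⊕ ⊝ 1̂) ≡ γ̂² ⊗ lo (a ⊕ ⊝ b)
    eq₁ = l
      where
      l : ∀ a b → ((γ̂ ⊕ 1̂) ⊗ (⊝ (γ̂ ⊗ (⊝ (γ̂ ⊗ a) ⊕ ⊝ 0̂)) ⊕ ⊝ 0̂) ⊕ γ̂)
          ⊕ (1̂ ⊕ ⊝ ((γ̂ ⊕ 1̂) ⊗ (⊝ (γ̂ ⊗ (⊝ (γ̂ ⊗ b) ⊕ ⊝ 0̂)) ⊕ ⊝ 0̂)))
          ⊕ (γ̂ ⊗ (γ̂ ⊗ γ̂) ⊕ ⊝ γ̂ ⊕ ⊝ 1̂) ≡ (γ̂ ⊗ γ̂) ⊗ ((γ̂ ⊕ 1̂) ⊗ (a ⊕ ⊝ b) ⊕ γ̂)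
      l = solve-∀ ℤ[γ]-ring
    eq₂ : ∀ a b → hi (shift² a) ⊕ lo (shift² b) ⊕ (γ̂² ⊕ ⊝ γ̂ ⊕ ⊝ 1̂) ≡ γ̂² ⊗ hi (a ⊕ ⊝ b)
    eq₂ = l
      where
      l : ∀ a b → (1̂ ⊕ ⊝ ((γ̂ ⊕ 1̂) ⊗ (⊝ (γ̂ ⊗ (⊝ (γ̂ ⊗ a) ⊕ ⊝ 0̂)) ⊕ ⊝ 0̂)))
          ⊕ ((γ̂ ⊕ 1̂) ⊗ (⊝ (γ̂ ⊗ (⊝ (γ̂ ⊗ b) ⊕ ⊝ 0̂)) ⊕ ⊝ 0̂) ⊕ γ̂)
          ⊕ (γ̂ ⊗ γ̂ ⊕ ⊝ γ̂ ⊕ ⊝ 1̂) ≡ (γ̂ ⊗ γ̂) ⊗ (1̂ ⊕ ⊝ ((γ̂ ⊕ 1̂) ⊗ (a ⊕ ⊝ b)))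
      l = solve-∀ ℤ[γ]-ring

  shift-unshifts : ∀ k w → shift (unshifts (suc k) w) 0ℤ ≡ unshifts k w
  shift-unshifts k w = shift-unshift (unshifts k w)

  -- Two extra leading zeros make room for x ± y in the interval.
  common-length : ∀ {v w} → Integer v → Integer w → ∃ λ k →
    (Reach k (unshifts k v) × Inside (shift² (unshifts k v))) ×
    (Reach k (unshifts k w) × Inside (shift² (unshifts k w)))
  common-length {v} {w} (i , rv) (j , rw) = suc (suc m) ,
    padded (unshifts-reach-mono (ℕₚ.≤⇒≤′ (ℕₚ.m≤m⊔n i j)) rv) ,
    padded (unshifts-reach-mono (ℕₚ.≤⇒≤′ (ℕₚ.m≤n⊔m i j)) rw)
    where
    m : ℕ
    m = i ℕ.⊔ j
    padded : ∀ {u} → Reach m (unshifts m u) →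
             Reach (suc (suc m)) (unshifts (suc (suc m)) u) × Inside (shift² (unshifts (suc (suc m)) u))
    padded {u} r = unshifts-reach-mono (ℕₚ.≤⇒≤′ (ℕₚ.m≤n+m m 2)) r , subst Inside
      (sym (trans (cong (λ t → shift t 0ℤ) (shift-unshifts (suc m) u)) (shift-unshifts m u))) (reach⇒inside r)

  fr-sum : ∀ {v w} → Integer v → Integer w → ∀ {z} → z ≃ embed (v ⊕ w) → fr[ z ]≤ 6
  fr-sum {v} {w} iv iw {z} z≃ =
    let k , (rv , v∈) , (rw , w∈) = common-length iv iw
        a = unshifts k v
        b = unshifts k w in
    reach⇒fr≤ {6} {z} {v ⊕ w} z≃ k (subst (Reach (k ℕ.+ 6)) (sym (unshifts-⊕ k v w))
      -- The automaton starts at `(a + b) − a − b = 0`, the first listed state.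
      (reach-sum (a ⊕ b) rv rw (inside-sum a b v∈ w∈) (subst (_∈ states) (sym (state a b)) (here refl))))
    where
    state : ∀ a b → a ⊕ b ⊕ ⊝ a ⊕ ⊝ b ≡ 0̂
    state = solve-∀ ℤ[γ]-ring

  fr-difference : ∀ {v w} → Integer v → Integer w → ∀ {z} → z ≃ embed v - embed w → fr[ z ]≤ 6
  fr-difference {v} {w} iv iw {z} z≃ =
    let k , (rv , v∈) , (rw , w∈) = common-length iv iw
        a = unshifts k v
        b = unshifts k w in
    reach⇒fr≤ {6} {z} {v ⊕ ⊝ w} z≃′ k (subst (Reach (k ℕ.+ 6))
      (sym (trans (unshifts-⊕ k v (⊝ w)) (cong (unshifts k v ⊕_) (unshifts-⊝ k w))))
      (reach-difference (a ⊕ ⊝ b) rv rw (inside-difference a b v∈ w∈)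
        (subst (_∈ states) (sym (state a b)) (here refl))))
    where
    state : ∀ a b → a ⊕ ⊝ (a ⊕ ⊝ b) ⊕ ⊝ b ≡ 0̂
    state = solve-∀ ℤ[γ]-ring
    z≃′ : z ≃ embed (v ⊕ ⊝ w)
    z≃′ = ≃-trans {z} {embed v - embed w} {embed (v ⊕ ⊝ w)} z≃
      (≃-trans {embed v - embed w} {embed v + embed (⊝ w)} {embed (v ⊕ ⊝ w)}
        (+-cong {embed v} {embed v} { - embed w} {embed (⊝ w)} (≃-refl {embed v})
          (≃-sym {embed (⊝ w)} { - embed w} (embed-⊝ w)))
        (≃-sym {embed (v ⊕ ⊝ w)} {embed v + embed (⊝ w)} (embed-⊕ v (⊝ w))))

  fr-integers : ∀ {x y} → ℤ₋ᵦ x → ℤ₋ᵦ y → fr[ x + y ]≤ 6 × fr[ x - y ]≤ 6 × fr[ - x ]≤ 6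
  fr-integers {x} {y} x∈ y∈ =
    let v , x≃v , iv = ℤ₋ᵦ⇒integer {x} x∈
        w , y≃w , iw = ℤ₋ᵦ⇒integer {y} y∈
        -x≃-v        = neg-cong {x} {embed v} x≃v in
      fr-sum {v} {w} iv iw {x + y} (≃-trans {x + y} {embed v + embed w} {embed (v ⊕ w)}
        (+-cong {x} {embed v} {y} {embed w} x≃v y≃w) (≃-sym {embed (v ⊕ w)} {embed v + embed w} (embed-⊕ v w)))
    , fr-difference {v} {w} iv iw {x - y}
        (+-cong {x} {embed v} { - y} { - embed w} x≃v (neg-cong {y} {embed w} y≃w))
    -- `−x` is treated as `0 − x`, with 0 an integer of length 0.
    , fr-difference {0̂} {v} (0 , done) iv { - x} (≃-trans { - x} { - embed v} {embed 0̂ - embed v} -x≃-v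
        (≡⇒≃ { - embed v} {embed 0̂ - embed v} (λ n → sym (trans
          (cong (ℚ._- seq (embed v) n) (eval-κ 0ℤ (seq γ n))) (ℚₚ.+-identityˡ (ℚ.- seq (embed v) n))))))

theorem1 : (γ : ℝ) (root : IsTribonacciConstant γ) →
    let open NegativeBase γ (tribonacci>1 γ root) in
    (x y : ℝ) → ℤ₋ᵦ x → ℤ₋ᵦ y →
    fr[ x + y ]≤ 6 × fr[ x - y ]≤ 6 × fr[ - x ]≤ 6
theorem1 γ root x y = TribonacciBase.fr-integers γ root {x} {y}
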